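{- Let $k$ and $s$ be fixed positive integers and, for $n\ge 1$, let $b_n^{(k,s)}$ be the number of vertices of the polytope $P_{n,k,s}$. The following hold as identities of formal power series (right-hand sides expanded at $x=0$). (1) If $s\in\{\lceil k/2\rceil,\ldots,k\}$, then $$1+\sum_{n\geq 1} b^{(k,s)}_{n} x^n=\frac{1}{1-kx+(k-s)(k-s-1)x^2}.$$ (2) If $k=s(r+1)$ for a nonnegative integer $r$, then $$1+\sum_{n\geq 1} b_{n}^{(k,s)} x^n=\frac{1+(rs-s-2)x-(rs-1)x^{2}+sx^{r+1}}{1-2(s+1)x+(s+1)^2x^{2}+sx^{r+1}-s^{2}(r+1)x^{r+2}+s(rs-1)x^{r+3}}.$$ In particular, if $s=1$, $$1+\sum_{n\geq 1} b_{n}^{(k,1)} x^n=\frac{1+(k-4)x-(k-2)x^2+x^k}{1-4x+4x^{2}+x^{k}-kx^{k+1}+(k-2)x^{k+2}}.$$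
   Context: For positive integers $n,k,s$ let $K=s(n-1)+k$ and let $e_0,\ldots,e_{K-1}$ be the standard basis of $\mathbb{R}^{K}$. For $0\le i\le n-1$ let $\lambda_i=\{si,si+1,\ldots,si+k-1\}$ and $\Delta_{\lambda_i}=\operatorname{conv}\{e_j: j\in\lambda_i\}$. Then $P_{n,k,s}=\sum_{i=0}^{n-1}\Delta_{\lambda_i}$ (Minkowski sum). -}

module Defs where

open import Level using (Level; _⊔_; suc; 0ℓ)
open import Algebra.Apartness using (HeytingField; HeytingCommutativeRing)
open import Algebra.Bundles using (CommutativeRing)
import Algebra.Properties.CommutativeMonoid.Sum as Sum
open import Data.Bool.Base using (if_then_else_)
open import Data.Fin.Base as Fin using (Fin; toℕ)
import Data.Fin.Properties as Fin
open import Data.Integer.Base as ℤ using (ℤ; +_)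
import Data.Integer.Properties as ℤ
open import Data.Nat.Base as ℕ using (ℕ; zero)
import Data.Nat.Properties as ℕ
open import Data.Product.Base using (∃; ∃₂; ∃-syntax; _×_; _,_; proj₁)
open import Data.Rational.Base as ℚ using (ℚ)
import Data.Rational.Properties as ℚ
open import Data.Sum.Base using (_⊎_)
open import Data.Vec.Functional using (Vector; []; _∷_)
import Data.Vec.Functional.Relation.Binary.Equality.Setoid as VecEq
open import Function.Bundles using (Bijection)
open import Relation.Binary.Bundles using (Setoid)
open import Relation.Binary.Core using (Rel)
open import Relation.Binary.Definitions using (tri<; tri≈; tri>)
open import Relation.Binary.Structures using (IsStrictPartialOrder; IsStrictTotalOrder)
import Relation.Binary.Construct.On as On
open import Relation.Binary.PropositionalEquality as ≡ using (_≡_; _≗_; module ≡-Reasoning)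
open import Relation.Nullary using (¬_; does; contradiction)
open import Relation.Unary using (Pred; _∈_; _∩_; _≐_)

------------------------------------------------------------------------
-- Ordered fields

-- Points have coordinates in an arbitrary ordered field, so that ℝ is
-- covered however it is constructed.  The axioms are the constructive
-- ones: trichotomy is required only for elements that are apart, and
-- x ≤ y means ¬ (y < x).  Hence they hold for the real numbers both
-- classically (with # the negation of equality) and constructively,
-- and for ℚ (see ℚ-orderedField).  Tightness of # makes ≤ antisymmetric.

record OrderedField c ℓ₁ ℓ₂ ℓ₃ : Set (suc (c ⊔ ℓ₁ ⊔ ℓ₂ ⊔ ℓ₃)) where
  infix 4 _<_ _≤_
  field
    heytingField : HeytingField c ℓ₁ ℓ₂

  open HeytingField heytingField public

  field
    _<_                  : Rel Carrier ℓ₃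
    isStrictPartialOrder : IsStrictPartialOrder _≈_ _<_
    <⇒#                  : ∀ {x y} → x < y → x # y
    #⇒<⊎>                : ∀ {x y} → x # y → x < y ⊎ y < x
    +-monoˡ-<            : ∀ z {x y} → x < y → x + z < y + z
    *-pos                : ∀ {x y} → 0# < x → 0# < y → 0# < x * y

  _≤_ : Rel Carrier ℓ₃
  x ≤ y = ¬ (y < x)

  commutativeRing : CommutativeRing c ℓ₁
  commutativeRing = HeytingCommutativeRing.commutativeRing heytingCommutativeRing

------------------------------------------------------------------------
-- Polytopes over an ordered field

module Polytopes {c ℓ₁ ℓ₂ ℓ₃} (F : OrderedField c ℓ₁ ℓ₂ ℓ₃) where

  open OrderedField F
  open CommutativeRing commutativeRing using (+-commutativeMonoid)
  open Sum +-commutativeMonoid using (sum)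

  Point : ℕ → Set c
  Point d = Vector Carrier d

  pointSetoid : ℕ → Setoid c ℓ₁
  pointSetoid = VecEq.≋-setoid setoid

  open VecEq setoid using (_≋_)

  private variable
    ℓ ℓ′ : Level
    d    : ℕ

  sumᵖ : ∀ {m} → Vector (Point d) m → Point d
  sumᵖ p j = sum (λ i → p i j)

  infixr 7 _*ᵖ_
  _*ᵖ_ : Carrier → Point d → Point d
  (a *ᵖ x) j = a * x j

  infix 7 _·_
  _·_ : Point d → Point d → Carrier
  a · x = sum (λ j → a j * x j)

  basis : Fin d → Point d
  basis j l = if does (j Fin.≟ l) then 1# else 0#

  conv : Pred (Point d) ℓ → Pred (Point d) (c ⊔ ℓ₁ ⊔ ℓ₃ ⊔ ℓ)
  conv S x = ∃[ m ] ∃₂ λ (t : Vector Carrier m) (p : Vector (Point _) m) →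
    (∀ i → 0# ≤ t i) × sum t ≈ 1# × (∀ i → p i ∈ S) × x ≋ sumᵖ (λ i → t i *ᵖ p i)

  minkowskiSum : ∀ {n} → Vector (Pred (Point d) ℓ) n → Pred (Point d) (c ⊔ ℓ₁ ⊔ ℓ)
  minkowskiSum S x = ∃[ p ] (∀ i → p i ∈ S i) × x ≋ sumᵖ p

  IsFace : Pred (Point d) ℓ → Pred (Point d) ℓ′ → Set (c ⊔ ℓ₁ ⊔ ℓ₃ ⊔ ℓ ⊔ ℓ′)
  IsFace P Q = ∃₂ λ a a₀ →
    (∀ x → x ∈ P → a · x ≤ a₀) × Q ≐ (P ∩ λ x → a · x ≈ a₀)

  IsVertex : Pred (Point d) ℓ → Pred (Point d) (c ⊔ ℓ₁ ⊔ ℓ₃ ⊔ ℓ)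
  IsVertex P v = IsFace P (_≋ v)

  vertexSetoid : Pred (Point d) ℓ → Setoid (c ⊔ ℓ₁ ⊔ ℓ₃ ⊔ ℓ) ℓ₁
  vertexSetoid {d} P = On.setoid {B = ∃ (IsVertex P)} (pointSetoid d) proj₁

  HasVertexCount : Pred (Point d) ℓ → ℕ → Set (c ⊔ ℓ₁ ⊔ ℓ₃ ⊔ ℓ)
  HasVertexCount P m = Bijection (≡.setoid (Fin m)) (vertexSetoid P)

  -- Only meaningful for n ≥ 1, because of the truncated subtraction.
  dim : (n k s : ℕ) → ℕ
  dim n k s = s ℕ.* (n ℕ.∸ 1) ℕ.+ k

  block : (n k s : ℕ) → Fin n → Pred (Fin (dim n k s)) 0ℓ
  block n k s i j = s ℕ.* toℕ i ℕ.≤ toℕ j × toℕ j ℕ.< s ℕ.* toℕ i ℕ.+ k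

  simplex : Pred (Fin d) 0ℓ → Pred (Point d) (c ⊔ ℓ₁ ⊔ ℓ₃)
  simplex J = conv (λ x → ∃[ j ] j ∈ J × x ≋ basis j)

  polytope : (n k s : ℕ) → Pred (Point (dim n k s)) (c ⊔ ℓ₁ ⊔ ℓ₃)
  polytope n k s = minkowskiSum (λ i → simplex (block n k s i))

------------------------------------------------------------------------
-- Formal power series with integer coefficients

Series : Set
Series = ℕ → ℤ

open Sum ℤ.+-0-commutativeMonoid using (sum; sum-cong-≋)

infixl 6 _⊕_ _⊖_
infixl 7 _⊛_ _÷_
infix  8 _x^_

_x^_ : ℤ → ℕ → Series
(a x^ m) n = if does (m ℕ.≟ n) then a else + 0

_⊕_ _⊖_ _⊛_ _÷_ : Series → Series → Series

(A ⊕ B) n = A n ℤ.+ B n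

(A ⊖ B) n = A n ℤ.- B n

(A ⊛ B) n = sum {ℕ.suc n} (λ i → A (toℕ i) ℤ.* B (n ℕ.∸ toℕ i))

-- inversePrefix D n = [ q_{n-1} , … , q_0 ], where q_0 = 1 and
-- q_{m+1} = - (D_1 q_m + D_2 q_{m-1} + ⋯ + D_{m+1} q_0).
inversePrefix : Series → (n : ℕ) → Vector ℤ n
inversePrefix D zero                 = []
inversePrefix D (ℕ.suc zero)         = + 1 ∷ []
inversePrefix D (ℕ.suc n@(ℕ.suc _)) =
  ℤ.- sum (λ i → D (ℕ.suc (toℕ i)) ℤ.* inversePrefix D n i) ∷ inversePrefix D n

-- The expansion of 1 / D at x = 0, for D with constant coefficient 1
-- (see ⊛-inverseʳ); a junk value for other D.
inverse : Series → Series
inverse D n = inversePrefix D (ℕ.suc n) Fin.zero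

A ÷ D = A ⊛ inverse D

-- 1 + Σ_{n ≥ 1} b_n xⁿ; the value b 0 is not used.
genFun : (ℕ → ℕ) → Series
genFun b zero        = + 1
genFun b n@(ℕ.suc _) = + b n

------------------------------------------------------------------------
-- Checks on the definitions above

inversePrefix-lookup : ∀ D n (i : Fin (ℕ.suc n)) →
                       inversePrefix D (ℕ.suc n) i ≡ inverse D (n ℕ.∸ toℕ i)
inversePrefix-lookup D n         Fin.zero    = ≡.refl
inversePrefix-lookup D (ℕ.suc n) (Fin.suc i) = inversePrefix-lookup D n i

⊛-inverseʳ : ∀ D → D 0 ≡ + 1 → D ⊛ inverse D ≗ (+ 1) x^ 0
⊛-inverseʳ D D₀≡1 zero      rewrite D₀≡1 = ≡.refl
⊛-inverseʳ D D₀≡1 (ℕ.suc n) = begin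
  D 0 ℤ.* (ℤ.- q) ℤ.+ sum {ℕ.suc n} (λ i → D (ℕ.suc (toℕ i)) ℤ.* inverse D (n ℕ.∸ toℕ i))
    ≡⟨ ≡.cong₂ ℤ._+_ (≡.cong (ℤ._* (ℤ.- q)) D₀≡1)
         (sum-cong-≋ {ℕ.suc n} λ i → ≡.cong (D (ℕ.suc (toℕ i)) ℤ.*_)
                                   (≡.sym (inversePrefix-lookup D n i))) ⟩
  + 1 ℤ.* (ℤ.- q) ℤ.+ q
    ≡⟨ ≡.cong (ℤ._+ q) (ℤ.*-identityˡ (ℤ.- q)) ⟩
  ℤ.- q ℤ.+ q
    ≡⟨ ℤ.+-inverseˡ q ⟩
  + 0 ∎
  where
  open ≡-Reasoning
  q : ℤ
  q = sum (λ i → D (ℕ.suc (toℕ i)) ℤ.* inversePrefix D (ℕ.suc n) i)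

ℚ-orderedField : OrderedField 0ℓ 0ℓ 0ℓ 0ℓ
ℚ-orderedField = record
  { heytingField         = ℚ.heytingField
  ; _<_                  = ℚ._<_
  ; isStrictPartialOrder = IsStrictTotalOrder.isStrictPartialOrder ℚ.<-isStrictTotalOrder
  ; <⇒#                  = ℚ.<⇒≢
  ; #⇒<⊎>                = λ {x} {y} → ≢⇒<⊎> x y
  ; +-monoˡ-<            = λ z → ℚ.+-monoˡ-< z
  ; *-pos                = λ {x} {y} 0<x 0<y →
      ℚ.positive⁻¹ (x ℚ.* y)
        {{ℚ.pos*pos⇒pos x {{ℚ.positive 0<x}} y {{ℚ.positive 0<y}}}}
  }
  where
  ≢⇒<⊎> : ∀ x y → ¬ (x ≡ y) → x ℚ.< y ⊎ y ℚ.< x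
  ≢⇒<⊎> x y x≢y with ℚ.<-cmp x y
  ... | tri< x<y _ _ = _⊎_.inj₁ x<y
  ... | tri≈ _ x≡y _ = contradiction x≡y x≢y
  ... | tri> _ _ y<x = _⊎_.inj₂ y<x

{-# OPTIONS --safe #-}
module Submission where

-- A vertex of the Minkowski sum is the sum of the coordinates f(i) at which a
-- generic functional is maximal on each window λ_i, and it determines f.  Such
-- an f is a Markov chain: the next window keeps f(i), or takes a new
-- coordinate, or is unconstrained if f(i) has left the window.  Conversely a
-- chain is realized by a functional that goes up whenever a new coordinate
-- takes over and down whenever the old one expires.  So b_n counts the paths of
-- length n, which start from the position 0 since it constrains nothing.
-- Counting continuations by position p gives c_{n+1}(p) = c_{n+1}(0) for p < s
-- and c_{n+1}(s + p) = c_n(p) + u_n, where u_n counts continuations from the s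
-- new positions; in case (2) the count depends only on ⌊p/s⌋, which leaves
-- r + 1 linear equations over ℤ[[x]].

open import Defs
open import Algebra.Bundles using (CommutativeRing)
import Algebra.Apartness.Properties.HeytingCommutativeRing as Heyting
import Algebra.Properties.AbelianGroup as AbelianGroup
import Algebra.Properties.CommutativeMonoid.Sum as Sum
import Algebra.Properties.Monoid.Mult as Mult
import Algebra.Properties.Ring as Ring
import Algebra.Properties.Semiring.Sum as SemiringSum
import Algebra.Solver.Ring
open import Algebra.Solver.Ring.AlmostCommutativeRing
  using (fromCommutativeRing; _-Raw-AlmostCommutative⟶_)
open import Data.Fin.Base as Fin using (Fin; zero; suc; toℕ; fromℕ<)
import Data.Fin.Properties as Fin
open import Data.Integer.Base using (ℤ; +_)
import Data.Integer.Properties as ℤ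
open import Data.Integer.Tactic.RingSolver using (solve-∀)
open import Data.List.Base as List
  using (List; []; _∷_; [_]; _++_; length; applyUpTo; upTo; concatMap)
import Data.List.Properties as List
open import Data.List.Membership.Propositional using (find) renaming (_∈_ to _∈ˡ_)
open import Data.List.Membership.Propositional.Properties
  using (∈-lookup; ∈-concatMap⁺; ∈-concatMap⁻; ∈-map⁺; ∈-map⁻; ∈-upTo⁺; ∈-upTo⁻;
         ∈-applyUpTo⁺; ∈-applyUpTo⁻)
open import Data.List.Relation.Unary.All as All using ([]; _∷_)
import Data.List.Relation.Unary.All.Properties as All
open import Data.List.Relation.Unary.AllPairs as AllPairs using ([]; _∷_)
import Data.List.Relation.Unary.AllPairs.Properties as AllPairs
open import Data.List.Relation.Unary.Any as Any using (here; there)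
open import Data.List.Relation.Unary.Any.Properties using (lookup-index)
open import Data.List.Relation.Unary.Unique.Propositional using (Unique)
import Data.List.Relation.Unary.Unique.Propositional.Properties as Unique
open import Data.Maybe.Base as Maybe using (Maybe)
open import Data.Nat.Base as ℕ
  using (ℕ; zero; suc; NonZero; ⌈_/2⌉; ⌊_/2⌋; s<s; z<s)
import Data.Nat.ListAction as ℕ using (sum)
import Data.Nat.ListAction.Properties as ℕ using (sum-++)
import Data.Nat.Properties as ℕ
open import Data.Product.Base using (_×_; _,_; proj₁; proj₂; ∃; ∃₂)
open import Data.Sum.Base using (_⊎_; inj₁; inj₂; [_,_]′)
open import Data.Vec.Base using (Vec; []; _∷_; lookup; tabulate)
import Data.Vec.Properties as Vec
open import Data.Vec.Functional using (Vector; updateAt)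
import Data.Vec.Functional.Properties as Vector
import Data.Vec.Functional.Relation.Binary.Equality.Setoid as VecEq
open import Data.Vec.Relation.Unary.Linked using (Linked; [-]; _∷_)
import Data.Vec.Relation.Unary.Linked.Properties as Linked
open import Effect.Monad using (RawMonad)
open import Function.Base using (_∘_; const)
open import Function.Bundles using (Bijection)
open import Level using (0ℓ; _⊔_)
open import Relation.Binary.Definitions using (Transitive; tri<; tri≈; tri>)
open import Relation.Binary.PropositionalEquality as ≡ using (_≡_; _≢_; _≗_)
open import Relation.Binary.Structures using (IsStrictPartialOrder)
open import Relation.Nullary using (¬_; Dec; yes; no; contradiction)
open import Relation.Nullary.Decidable
  using (¬¬-excluded-middle; decidable-stable; dec⇒maybe; _×-dec_)
open import Relation.Nullary.Negation using (¬¬-Monad; ¬¬-map)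
open import Relation.Unary using (Pred; Decidable; _∈_)

-- Ordered fields and sums of simplices

-- The order of the field is not decidable, so the coordinates of a functional that defines a vertex
-- can be compared only under a double negation. That is enough, because the goal is an equation
-- between natural numbers. Conversely, the functional built from a path has natural numbers as
-- coordinates, and natural multiples of 1 are ordered correctly in every ordered field.
--
-- A path records constraints between neighbouring windows only, whereas a functional must be
-- consistent on every pair of overlapping windows. The gap is closed by comparing neighbouring
-- states through a relation that is transitive: window starts and selected positions both move
-- monotonically to the right.
--
-- In case (2) the number of equations depends on the variable r. Closed forms of the recurrences
-- let x^r enter as an independent quantity y, after which finitely many polynomial identities
-- suffice. Geometric sums would require division by 1 - x; instead the equations are multiplied by
-- 1 - x, and this factor is cancelled at the very end.

module OrderedFieldProperties {c ℓ₁ ℓ₂ ℓ₃} (F : OrderedField c ℓ₁ ℓ₂ ℓ₃) where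

  open OrderedField F hiding (zero)
  open CommutativeRing commutativeRing using (+-monoid; +-commutativeMonoid; ring; +-abelianGroup)
  open IsStrictPartialOrder isStrictPartialOrder public using (<-respˡ-≈; <-respʳ-≈)
    renaming (irrefl to <-irrefl; trans to <-trans; asym to <-asym)
  open Sum +-commutativeMonoid using (sum)
  open Mult +-monoid public using () renaming (_×_ to _×ᶠ_)

  ≤-reflexive : ∀ {x y} → x ≈ y → x ≤ y
  ≤-reflexive x≈y y<x = <-irrefl (sym x≈y) y<x

  ≤-antisym : ∀ {x y} → x ≤ y → y ≤ x → x ≈ y
  ≤-antisym x≤y y≤x = proj₁ (tight _ _) ([ y≤x , x≤y ]′ ∘ #⇒<⊎>)

  -- Since `≤` is a negated `<`, the assumption z < x has to be refuted; cotransitivity of `#`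
  -- separates y from z or from x, and either case contradicts a hypothesis.
  ≤-trans : ∀ {x y z} → x ≤ y → y ≤ z → x ≤ z
  ≤-trans {x} {y} {z} x≤y y≤z z<x with #-cotrans (<⇒# z<x) y
  ... | inj₁ z#y = [ y≤z , (λ y<z → x≤y (<-trans y<z z<x)) ]′ (#⇒<⊎> z#y)
  ... | inj₂ y#x = [ x≤y , (λ x<y → y≤z (<-trans z<x x<y)) ]′ (#⇒<⊎> y#x)

  ≤-respˡ-≈ : ∀ {x y z} → x ≈ y → x ≤ z → y ≤ z
  ≤-respˡ-≈ x≈y = ≤-trans (≤-reflexive (sym x≈y))

  ≤-respʳ-≈ : ∀ {x y z} → x ≈ y → z ≤ x → z ≤ y
  ≤-respʳ-≈ x≈y z≤x = ≤-trans z≤x (≤-reflexive x≈y)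

  x+y-y≈x : ∀ x y → x + y - y ≈ x
  x+y-y≈x x y = trans (+-assoc x y (- y)) (trans (+-congˡ (-‿inverseʳ y)) (+-identityʳ x))

  +-monoˡ-≤ : ∀ z {x y} → x ≤ y → x + z ≤ y + z
  +-monoˡ-≤ z {x} {y} x≤y y+z<x+z =
    x≤y (<-respˡ-≈ (x+y-y≈x y z) (<-respʳ-≈ (x+y-y≈x x z) (+-monoˡ-< (- z) y+z<x+z)))

  +-monoʳ-≤ : ∀ z {x y} → x ≤ y → z + x ≤ z + y
  +-monoʳ-≤ z {x} {y} x≤y =
    ≤-respˡ-≈ (+-comm x z) (≤-respʳ-≈ (+-comm y z) (+-monoˡ-≤ z x≤y))

  +-mono-≤ : ∀ {x y z w} → x ≤ y → z ≤ w → x + z ≤ y + w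
  +-mono-≤ {x} {y} {z} {w} x≤y z≤w = ≤-trans (+-monoˡ-≤ z x≤y) (+-monoʳ-≤ y z≤w)

  +-cancel-≤ : ∀ {x y z w} → x ≤ y → z ≤ w → x + z ≈ y + w → x ≈ y × z ≈ w
  +-cancel-≤ {x} {y} {z} {w} x≤y z≤w eq =
      ≤-antisym x≤y (λ x<y →
        +-monoʳ-≤ y z≤w (<-respˡ-≈ eq (+-monoˡ-< z x<y)))
    , ≤-antisym z≤w (λ z<w →
        +-monoˡ-≤ w x≤y (<-respˡ-≈ (trans (+-comm z x) eq)
          (<-respʳ-≈ (+-comm w x) (+-monoˡ-< x z<w))))

  sum-mono-≤ : ∀ {n} {f g : Vector Carrier n} → (∀ i → f i ≤ g i) → sum f ≤ sum g
  sum-mono-≤ {zero}  f≤g = ≤-reflexive refl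
  sum-mono-≤ {suc n} f≤g = +-mono-≤ (f≤g zero) (sum-mono-≤ (f≤g ∘ suc))

  -- Source of all equality cases below: a functional reaches its bound on a convex combination or a
  -- Minkowski sum only if it does so in every term.
  sum-cancel-≤ : ∀ {n} {f g : Vector Carrier n} →
    (∀ i → f i ≤ g i) → sum f ≈ sum g → ∀ i → f i ≈ g i
  sum-cancel-≤ {suc n} f≤g eq i with +-cancel-≤ (f≤g zero) (sum-mono-≤ (f≤g ∘ suc)) eq | i
  ... | f₀≈g₀ , _  | zero  = f₀≈g₀
  ... | _ , tails≈ | suc j = sum-cancel-≤ (f≤g ∘ suc) tails≈ j

  *-monoˡ-< : ∀ {t x y} → 0# < t → x < y → t * x < t * y
  *-monoˡ-< {t} {x} {y} 0<t x<y =
    <-respˡ-≈ (+-identityˡ (t * x)) (<-respʳ-≈ eq (+-monoˡ-< (t * x) (*-pos 0<t 0<y-x)))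
    where
    0<y-x : 0# < y - x
    0<y-x = <-respˡ-≈ (-‿inverseʳ x) (+-monoˡ-< (- x) x<y)
    eq : t * (y - x) + t * x ≈ t * y
    eq = trans (sym (distribˡ t (y - x) x)) (*-congˡ
      (trans (+-assoc y (- x) x) (trans (+-congˡ (-‿inverseˡ x)) (+-identityʳ y))))

  -- The goal is a negation. By tightness, t * y < t * x rules out that t fails to be apart from 0
  -- or x from y, so both apartness facts may be assumed and the strict case applies.
  *-monoˡ-≤ : ∀ {t x y} → 0# ≤ t → x ≤ y → t * x ≤ t * y
  *-monoˡ-≤ {t} {x} {y} 0≤t x≤y ty<tx = ¬t#0 λ t#0 → ¬x#y λ x#y →
    [ 0≤t , (λ 0<t → [ (λ x<y → <-asym ty<tx (*-monoˡ-< 0<t x<y)) , x≤y ]′ (#⇒<⊎> x#y)) ]′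
      (#⇒<⊎> t#0)
    where
    ¬t#0 : ¬ ¬ (t # 0#)
    ¬t#0 ¬t#0 = <-irrefl (trans (t*≈0 y) (sym (t*≈0 x))) ty<tx
      where
      t*≈0 : ∀ z → t * z ≈ 0#
      t*≈0 z = trans (*-congʳ (proj₁ (tight t 0#) ¬t#0)) (zeroˡ z)
    ¬x#y : ¬ ¬ (x # y)
    ¬x#y ¬x#y = <-irrefl (*-congˡ (sym (proj₁ (tight x y) ¬x#y))) ty<tx

  *-cancel-<⇒≈0 : ∀ {t x y} → 0# ≤ t → x < y → t * x ≈ t * y → t ≈ 0#
  *-cancel-<⇒≈0 {t} 0≤t x<y eq = proj₁ (tight t 0#) λ t#0 →
    [ 0≤t , (λ 0<t → <-irrefl eq (*-monoˡ-< 0<t x<y)) ]′ (#⇒<⊎> t#0)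

  0<1 : 0# < 1#
  0<1 with #⇒<⊎> (Heyting.1#0 heytingCommutativeRing)
  ... | inj₂ 0<1 = 0<1
  ... | inj₁ 1<0 = <-respʳ-≈ -1*-1≈1 (*-pos 0<-1 0<-1)
    where
    open Ring ring using (-1*x≈-x)
    open AbelianGroup +-abelianGroup using (⁻¹-involutive)
    0<-1 : 0# < - 1#
    0<-1 = <-respˡ-≈ (-‿inverseʳ 1#) (<-respʳ-≈ (+-identityˡ (- 1#)) (+-monoˡ-< (- 1#) 1<0))
    -1*-1≈1 : - 1# * - 1# ≈ 1#
    -1*-1≈1 = trans (-1*x≈-x (- 1#)) (⁻¹-involutive 1#)

  0≤1 : 0# ≤ 1#
  0≤1 = <-asym 0<1

  0≉1 : ¬ 0# ≈ 1#
  0≉1 0≈1 = <-irrefl 0≈1 0<1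

  -- Lets a functional be prescribed by natural numbers over any ordered field.
  ×ᶠ-mono-< : ∀ {m n} → m ℕ.< n → m ×ᶠ 1# < n ×ᶠ 1#
  ×ᶠ-mono-< {m} {suc n} m<1+n with ℕ.m≤n⇒m<n∨m≡n (ℕ.s≤s⁻¹ m<1+n)
  ... | inj₂ ≡.refl = <-respˡ-≈ (+-identityˡ (n ×ᶠ 1#)) (+-monoˡ-< (n ×ᶠ 1#) 0<1)
  ... | inj₁ m<n    = <-trans (×ᶠ-mono-< m<n)
    (<-respˡ-≈ (+-identityˡ (n ×ᶠ 1#)) (+-monoˡ-< (n ×ᶠ 1#) 0<1))

-- Vertices of Minkowski sums of simplices as strict maximizers

module SumsOfSimplices {c ℓ₁ ℓ₂ ℓ₃} (F : OrderedField c ℓ₁ ℓ₂ ℓ₃) where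

  open OrderedField F hiding (zero)
  open OrderedFieldProperties F
  open Polytopes F
  open CommutativeRing commutativeRing using (+-commutativeMonoid; semiring)
  open Sum +-commutativeMonoid using (sum; sum-cong-≋; sum-replicate-zero; ∑-comm)
  open SemiringSum semiring using (*-distribˡ-sum; *-distribʳ-sum)
  open VecEq setoid using (_≋_; ≋-refl; ≋-sym; ≋-trans)

  private variable
    d m n : ℕ

  sum-zero : (f : Vector Carrier n) → (∀ i → f i ≈ 0#) → sum f ≈ 0#
  sum-zero {n} f f≈0 = trans (sum-cong-≋ f≈0) (sum-replicate-zero n)

  basis-≡ : (j : Fin d) → basis j j ≡ 1#
  basis-≡ zero    = ≡.refl
  basis-≡ (suc j) = basis-≡ j

  basis-≢ : {j l : Fin d} → j ≢ l → basis j l ≡ 0#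
  basis-≢ {j = j} {l} j≢l with j Fin.≟ l
  ... | yes j≡l = contradiction j≡l j≢l
  ... | no  _   = ≡.refl

  sumᵖ-cong : {p q : Vector (Point d) m} → (∀ i → p i ≋ q i) → sumᵖ p ≋ sumᵖ q
  sumᵖ-cong p≋q j = sum-cong-≋ λ i → p≋q i j

  ·-congˡ : (a : Point d) {x y : Point d} → x ≋ y → a · x ≈ a · y
  ·-congˡ a x≋y = sum-cong-≋ λ j → *-congˡ (x≋y j)

  ·-sumᵖ : (a : Point d) (p : Vector (Point d) m) → a · sumᵖ p ≈ sum (λ i → a · p i)
  ·-sumᵖ a p = trans (sum-cong-≋ λ j → *-distribˡ-sum (a j) (λ i → p i j))
    (∑-comm λ j i → a j * p i j)

  ·-*ᵖ : (a : Point d) (t : Carrier) (x : Point d) → a · (t *ᵖ x) ≈ t * (a · x)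
  ·-*ᵖ a t x = trans (sum-cong-≋ λ j → lemma (a j) (x j)) (sym (*-distribˡ-sum t λ j → a j * x j))
    where
    lemma : ∀ u v → u * (t * v) ≈ t * (u * v)
    lemma u v = trans (sym (*-assoc u t v)) (trans (*-congʳ (*-comm u t)) (*-assoc t u v))

  ·-basis : (a : Point d) (j : Fin d) → a · basis j ≈ a j
  ·-basis a zero    = trans (+-cong (*-identityʳ (a zero)) (sum-zero _ λ l → zeroʳ (a (suc l))))
    (+-identityʳ (a zero))
  ·-basis a (suc j) = trans (+-cong (zeroʳ (a zero)) (·-basis (a ∘ suc) j)) (+-identityˡ (a (suc j)))

  ·-convex : (a : Point d) (t : Vector Carrier m) (q : Vector (Point d) m) →
    a · sumᵖ (λ l → t l *ᵖ q l) ≈ sum (λ l → t l * (a · q l))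
  ·-convex a t q = trans (·-sumᵖ a (λ l → t l *ᵖ q l)) (sum-cong-≋ λ l → ·-*ᵖ a (t l) (q l))

  weights-const : (t : Vector Carrier m) → sum t ≈ 1# → ∀ x → sum (λ l → t l * x) ≈ x
  weights-const t Σt≈1 x = trans (sym (*-distribʳ-sum x t)) (trans (*-congʳ Σt≈1) (*-identityˡ x))

  basis∈simplex : {J : Pred (Fin d) 0ℓ} {j : Fin d} → J j → basis j ∈ simplex J
  basis∈simplex {j = j} j∈J =
    1 , (λ _ → 1#) , (λ _ → basis j) , (λ _ → 0≤1) , +-identityʳ 1# ,
    (λ _ → j , j∈J , ≋-refl) ,
    λ l → sym (trans (+-identityʳ _) (*-identityˡ (basis j l)))

  simplex-≤ : {J : Pred (Fin d) 0ℓ} (a : Point d) {b : Carrier} → (∀ j → J j → a j ≤ b) →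
    ∀ {x} → x ∈ simplex J → a · x ≤ b
  simplex-≤ a {b} a≤b (_ , t , q , 0≤t , Σt≈1 , q∈ , x≋) =
    ≤-respˡ-≈ (sym (trans (·-congˡ a x≋) (·-convex a t q)))
      (≤-respʳ-≈ (weights-const t Σt≈1 b)
        (sum-mono-≤ λ l → *-monoˡ-≤ (0≤t l) (a·q≤b l)))
    where
    a·q≤b : ∀ l → a · q l ≤ b
    a·q≤b l with q∈ l
    ... | j , j∈J , q≋ = ≤-respˡ-≈ (sym (trans (·-congˡ a q≋) (·-basis a j))) (a≤b j j∈J)

  -- Equality in the bound forces every term t l * (a · q l) to equal t l * a j₀. A point other than
  -- `basis j₀` has a strictly smaller value, so its weight is 0, and all the weight rests on
  -- `basis j₀`.
  simplex-max-unique : {J : Pred (Fin d) 0ℓ} (a : Point d) (j₀ : Fin d) →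
    (∀ j → J j → j ≢ j₀ → a j < a j₀) → ∀ {x} → x ∈ simplex J → a · x ≈ a j₀ → x ≋ basis j₀
  simplex-max-unique {J = J} a j₀ a<a₀ {x} (_ , t , q , 0≤t , Σt≈1 , q∈ , x≋) a·x≈ =
    ≋-trans x≋ (≋-trans (sumᵖ-cong tq≋) λ l → weights-const t Σt≈1 (basis j₀ l))
    where
    a≤a₀ : ∀ j → J j → a j ≤ a j₀
    a≤a₀ j j∈J with j Fin.≟ j₀
    ... | yes ≡.refl = ≤-reflexive refl
    ... | no  j≢j₀   = <-asym (a<a₀ j j∈J j≢j₀)
    a·q≈ : ∀ l → a · q l ≈ a (proj₁ (q∈ l))
    a·q≈ l = trans (·-congˡ a (proj₂ (proj₂ (q∈ l)))) (·-basis a (proj₁ (q∈ l)))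
    terms≈ : ∀ l → t l * (a · q l) ≈ t l * a j₀
    terms≈ = sum-cancel-≤
      (λ l → *-monoˡ-≤ (0≤t l)
        (≤-respˡ-≈ (sym (a·q≈ l)) (a≤a₀ (proj₁ (q∈ l)) (proj₁ (proj₂ (q∈ l))))))
      (trans (sym (trans (·-congˡ a x≋) (·-convex a t q)))
        (trans a·x≈ (sym (weights-const t Σt≈1 (a j₀)))))
    tq≋ : ∀ l → t l *ᵖ q l ≋ t l *ᵖ basis j₀
    tq≋ l with q∈ l | a·q≈ l
    ... | j , j∈J , q≋ | a·q≈aj with j Fin.≟ j₀
    ... | yes ≡.refl = λ i → *-congˡ (q≋ i)
    ... | no  j≢j₀   = λ i → trans (trans (*-congʳ t≈0) (zeroˡ (q l i)))
                               (sym (trans (*-congʳ t≈0) (zeroˡ (basis j₀ i))))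
      where
      t≈0 : t l ≈ 0#
      t≈0 = *-cancel-<⇒≈0 (0≤t l) (a<a₀ j j∈J j≢j₀)
        (trans (*-congˡ (sym a·q≈aj)) (terms≈ l))

  -- Strictness of the maximum makes the face cut out by `a` a single point and makes that point
  -- remember `f`.
  Selects : (a : Point d) (J : Vector (Pred (Fin d) 0ℓ) n) (f : Vector (Fin d) n) → Set ℓ₃
  Selects a J f = ∀ i → J i (f i) × (∀ j → J i j → j ≢ f i → a j < a (f i))

  select : Vector (Fin d) n → Point d
  select f = sumᵖ (basis ∘ f)

  ·-select : (a : Point d) (f : Vector (Fin d) n) → a · select f ≈ sum (a ∘ f)
  ·-select a f = trans (·-sumᵖ a (basis ∘ f)) (sum-cong-≋ λ i → ·-basis a (f i))

  module _ (J : Vector (Pred (Fin d) 0ℓ) n) where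

    private
      P : Pred (Point d) (c ⊔ ℓ₁ ⊔ ℓ₃)
      P = minkowskiSum (λ i → simplex (J i))

    select∈ : {f : Vector (Fin d) n} → (∀ i → J i (f i)) → select f ∈ P
    select∈ {f} f∈ = basis ∘ f , (λ i → basis∈simplex (f∈ i)) , ≋-refl

    minkowskiSum-≤ : (a : Point d) (f : Vector (Fin d) n) → (∀ i j → J i j → a j ≤ a (f i)) →
      ∀ {x} → x ∈ P → a · x ≤ sum (a ∘ f)
    minkowskiSum-≤ a f a≤ (p , p∈ , x≋) =
      ≤-respˡ-≈ (sym (trans (·-congˡ a x≋) (·-sumᵖ a p)))
        (sum-mono-≤ λ i → simplex-≤ a (a≤ i) (p∈ i))

    module _ {a : Point d} {f : Vector (Fin d) n} (sel : Selects a J f) where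

      selects-≤ : ∀ i j → J i j → a j ≤ a (f i)
      selects-≤ i j j∈ with j Fin.≟ f i
      ... | yes ≡.refl = ≤-reflexive refl
      ... | no  j≢fi   = <-asym (proj₂ (sel i) j j∈ j≢fi)

      selects⇒vertex : IsVertex P (select f)
      selects⇒vertex =
        a , sum (a ∘ f) , (λ _ → minkowskiSum-≤ a f selects-≤) ,
        (λ x≋ → (basis ∘ f , (λ i → basis∈simplex (proj₁ (sel i))) , x≋) ,
                trans (·-congˡ a x≋) (·-select a f)) ,
        λ ((p , p∈ , x≋) , a·x≈) → ≋-trans x≋ (sumᵖ-cong λ i →
          simplex-max-unique a (f i) (proj₂ (sel i)) (p∈ i)
            (sum-cancel-≤ (λ i → simplex-≤ a (selects-≤ i) (p∈ i))
              (trans (sym (trans (·-congˡ a x≋) (·-sumᵖ a p))) a·x≈) i))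

      -- Evaluating `a` at the common point turns every inequality a (g i) ≤ a (f i) into an
      -- equality, which strictness allows only when g i is f i.
      selects-unique : {g : Vector (Fin d) n} → (∀ i → J i (g i)) → select g ≋ select f →
        ∀ i → g i ≡ f i
      selects-unique {g} g∈ g≋f i with g i Fin.≟ f i
      ... | yes gi≡fi = gi≡fi
      ... | no  gi≢fi = contradiction (proj₂ (sel i) (g i) (g∈ i) gi≢fi)
        (<-irrefl (sum-cancel-≤ (λ i → selects-≤ i (g i) (g∈ i))
          (trans (sym (·-select a g)) (trans (·-congˡ a g≋f) (·-select a f))) i))

    module _ (J? : ∀ i → Decidable (J i)) (J-nonempty : ∀ i → ∃ (J i)) where

      argmax : ∀ {d} (a : Point d) → (∀ j l → Dec (a j < a l)) →
        {I : Pred (Fin d) 0ℓ} → Decidable I →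
        (∃ λ j → I j × (∀ l → I l → a l ≤ a j)) ⊎ (∀ j → ¬ I j)
      argmax {zero}  a a<? I? = inj₂ λ ()
      argmax {suc d} a a<? I? with I? zero | argmax (a ∘ suc) (λ j l → a<? (suc j) (suc l)) (I? ∘ suc)
      ... | no  0∉I | inj₁ (j , j∈I , a≤) =
        inj₁ (suc j , j∈I , λ { zero 0∈I → contradiction 0∈I 0∉I ; (suc l) → a≤ l })
      ... | no  0∉I | inj₂ empty = inj₂ λ { zero → 0∉I ; (suc l) → empty l }
      ... | yes 0∈I | inj₂ empty =
        inj₁ (zero , 0∈I , λ { zero _ → ≤-reflexive refl ; (suc l) l∈I → contradiction l∈I (empty l) })
      ... | yes 0∈I | inj₁ (j , j∈I , a≤) with a<? (suc j) zero
      ...   | yes a<a₀ = inj₁ (zero , 0∈I ,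
                λ { zero _ → ≤-reflexive refl ; (suc l) l∈I → ≤-trans (a≤ l l∈I) (<-asym a<a₀) })
      ...   | no  a≮a₀ = inj₁ (suc j , j∈I , λ { zero _ → a≮a₀ ; (suc l) → a≤ l })

      -- Comparisons of coordinates are not decidable, so the selection attached
      -- to a vertex exists only up to double negation.
      vertex⇒selects : ∀ {v} → IsVertex P v →
        ¬ ¬ (∃₂ λ a f → Selects a J f × select f ≋ v)
      vertex⇒selects {v} (a , a₀ , P≤a₀ , v⊆ , ⊆v) =
        ¬¬-map (λ a<? → a , chosen a<? , selects a<? , select≋v a<?) comparisons
        where
        comparisons : ¬ ¬ (∀ j l → Dec (a j < a l))
        -- There are finitely many pairs, so the doubly negated decisions combine into one double
        -- negation.
        comparisons = Fin.sequence applicative λ j → Fin.sequence applicative λ l → ¬¬-excluded-middle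
          where applicative = RawMonad.rawApplicative ¬¬-Monad

        module _ (a<? : ∀ j l → Dec (a j < a l)) where

          maximal : ∀ i → ∃ λ j → J i j × (∀ l → J i l → a l ≤ a j)
          maximal i with argmax a a<? (J? i)
          ... | inj₁ max   = max
          ... | inj₂ empty = contradiction (proj₂ (J-nonempty i)) (empty _)

          chosen : Vector (Fin d) n
          chosen = proj₁ ∘ maximal

          chosen∈ : ∀ i → J i (chosen i)
          chosen∈ = proj₁ ∘ proj₂ ∘ maximal

          a≤chosen : ∀ i j → J i j → a j ≤ a (chosen i)
          a≤chosen = proj₂ ∘ proj₂ ∘ maximal

          Σa≈a₀ : sum (a ∘ chosen) ≈ a₀
          Σa≈a₀ = ≤-antisym
            (≤-respˡ-≈ (·-select a chosen) (P≤a₀ _ (select∈ chosen∈)))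
            (≤-respˡ-≈ (proj₂ v∈) (minkowskiSum-≤ a chosen a≤chosen (proj₁ v∈)))
            where
            v∈ : v ∈ P × a · v ≈ a₀
            v∈ = v⊆ ≋-refl

          select≋v : select chosen ≋ v
          select≋v = ⊆v (select∈ chosen∈ , trans (·-select a chosen) Σa≈a₀)

          -- If j tied with the chosen coordinate of window i, exchanging the
          -- two would give a second maximizer, whose j-th coordinate is larger.
          no-tie : ∀ i j → J i j → j ≢ chosen i → ¬ a j ≈ a (chosen i)
          no-tie i j j∈ j≢ aj≈ = 0≉1 (trans
            (trans (sym (reflexive (basis-≢ (j≢ ∘ ≡.sym)))) (sum-cancel-≤ smaller (equal j) i))
            (reflexive (≡.trans (≡.cong (λ l → basis l j) exchanged-i) (basis-≡ j))))
            where
            exchanged : Vector (Fin d) n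
            exchanged = updateAt chosen i (const j)

            exchanged-i : exchanged i ≡ j
            exchanged-i = Vector.updateAt-updates i chosen

            exchanged-cases : ∀ l → (l ≡ i × exchanged l ≡ j) ⊎ exchanged l ≡ chosen l
            exchanged-cases l with l Fin.≟ i
            ... | yes ≡.refl = inj₁ (≡.refl , exchanged-i)
            ... | no  l≢i    = inj₂ (Vector.updateAt-minimal l i chosen l≢i)

            exchanged∈ : ∀ l → J l (exchanged l)
            exchanged∈ l with exchanged-cases l
            ... | inj₁ (≡.refl , eq) = ≡.subst (J i) (≡.sym eq) j∈
            ... | inj₂ eq            = ≡.subst (J l) (≡.sym eq) (chosen∈ l)

            a-exchanged : ∀ l → a (exchanged l) ≈ a (chosen l)
            a-exchanged l with exchanged-cases l
            ... | inj₁ (≡.refl , eq) = trans (reflexive (≡.cong a eq)) aj≈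
            ... | inj₂ eq            = reflexive (≡.cong a eq)

            equal : select chosen ≋ select exchanged
            equal = ≋-trans select≋v (≋-sym (⊆v (select∈ exchanged∈ ,
              trans (·-select a exchanged) (trans (sum-cong-≋ a-exchanged) Σa≈a₀))))

            smaller : ∀ l → basis (chosen l) j ≤ basis (exchanged l) j
            smaller l with exchanged-cases l
            ... | inj₂ eq = ≤-reflexive (reflexive (≡.cong (λ j′ → basis j′ j) (≡.sym eq)))
            ... | inj₁ (≡.refl , eq) =
              ≤-respˡ-≈ (reflexive (≡.sym (basis-≢ (j≢ ∘ ≡.sym))))
                (≤-respʳ-≈ (reflexive (≡.sym (≡.trans (≡.cong (λ j′ → basis j′ j) eq) (basis-≡ j)))) 0≤1)

          selects : Selects a J chosen
          selects i = chosen∈ i , beats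
            where
            beats : ∀ j → J i j → j ≢ chosen i → a j < a (chosen i)
            beats j j∈ j≢ with a<? j (chosen i)
            ... | yes aj<  = aj<
            ... | no  ¬aj< = contradiction (≤-antisym (a≤chosen i j j∈) ¬aj<) (no-tie i j j∈ j≢)

      -- N ≤ m because distinct codes give distinct vertices. For m ≤ N every vertex needs a code,
      -- which exists only up to double negation; this suffices since `≤` on natural numbers is
      -- decidable and hence stable.
      vertexCount : ∀ {m N} (φ : Fin N → Vector (Fin d) n) →
        (∀ {x y} → (∀ i → φ x i ≡ φ y i) → x ≡ y) →
        (∀ x → ∃ λ a → Selects a J (φ x)) →
        (∀ {a f} → Selects a J f → ∃ λ x → ∀ i → φ x i ≡ f i) →
        HasVertexCount P m → m ≡ N
      vertexCount {m} {N} φ φ-injective φ-selects φ-complete bijection =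
        ℕ.≤-antisym
          (decidable-stable (m ℕ.≤? N) (¬¬-map (λ code → Fin.injective⇒≤ (code-injective code)) codes))
          (Fin.injective⇒≤ {f = proj₁ ∘ preimage} preimage-injective)
        where
        open Bijection bijection using (to; injective; strictlySurjective)

        preimage : ∀ x → ∃ λ y → proj₁ (to y) ≋ select (φ x)
        preimage x = strictlySurjective (select (φ x) , selects⇒vertex (proj₂ (φ-selects x)))

        preimage-injective : ∀ {x y} → proj₁ (preimage x) ≡ proj₁ (preimage y) → x ≡ y
        preimage-injective {x} {y} eq = φ-injective
          (selects-unique (proj₂ (φ-selects y)) (λ i → proj₁ (proj₂ (φ-selects x) i))
            (≋-trans (≋-sym (proj₂ (preimage x)))
              (≡.subst (λ z → proj₁ (to z) ≋ select (φ y)) (≡.sym eq) (proj₂ (preimage y)))))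

        Code : Fin m → Set ℓ₁
        Code y = ∃ λ x → select (φ x) ≋ proj₁ (to y)

        codes : ¬ ¬ (∀ y → Code y)
        codes = Fin.sequence (RawMonad.rawApplicative ¬¬-Monad) λ y →
          ¬¬-map code (vertex⇒selects (proj₂ (to y)))
          where
          code : ∀ {y} → (∃₂ λ a f → Selects a J f × select f ≋ proj₁ (to y)) → Code y
          code (a , f , sel , f≋) with φ-complete sel
          ... | x , φx≡f = x ,
            ≋-trans (sumᵖ-cong λ i l → reflexive (≡.cong (λ j → basis j l) (φx≡f i))) f≋

        code-injective : (code : ∀ y → Code y) →
          ∀ {y z} → proj₁ (code y) ≡ proj₁ (code z) → y ≡ z
        code-injective code {y} {z} eq = injective (≋-trans (≋-sym (proj₂ (code y)))
          (≡.subst (λ x → select (φ x) ≋ proj₁ (to z)) (≡.sym eq) (proj₂ (code z))))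

-- Elimination in a commutative ring

module Elimination {c ℓ} (R : CommutativeRing c ℓ)
  (constants : CommutativeRing.rawRing ℤ.+-*-commutativeRing
                 -Raw-AlmostCommutative⟶ fromCommutativeRing R) where

  open CommutativeRing R
  open _-Raw-AlmostCommutative⟶_ constants using (+-homo) renaming (⟦_⟧ to ι)
  open import Relation.Binary.Reasoning.Setoid setoid

  constant-≟ : ∀ a b → Maybe (ι a ≈ ι b)
  constant-≟ a b = Maybe.map (λ { ≡.refl → refl }) (dec⇒maybe (a ℤ.≟ b))

  -- What the solver's constants 0 and 1 denote; not definitionally 0# and 1#.
  private
    𝟘 𝟙 : Carrier
    𝟘 = ι (+ 0)
    𝟙 = ι (+ 1)

  open Algebra.Solver.Ring _ _ constants constant-≟

  -- Here y stands for x^r, so x^(r+1) is x * y, and the identities remain polynomial although r is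
  -- a variable.
  numerator : (x y s r : Carrier) → Carrier
  numerator x y s r =
    𝟙 + (r * s - s - (𝟙 + 𝟙)) * x - (r * s - 𝟙) * (x * x) + s * (x * y)

  denominator : (x y s r : Carrier) → Carrier
  denominator x y s r =
    𝟙 - ((𝟙 + 𝟙) * (s + 𝟙)) * x + ((s + 𝟙) * (s + 𝟙)) * (x * x) + s * (x * y)
      - (s * s * (r + 𝟙)) * (x * (x * y)) + (s * (r * s - 𝟙)) * (x * (x * (x * y)))

  -- C and T are the series of the position classes 0 and r, Z is the sum over the classes 0 to r,
  -- and V carries the renewals. Inserting the T-equation into the V-equation gives a multiple `E`
  -- of V in terms of C alone. Multiplying the C-equation by `E` therefore removes V without any
  -- division.
  eliminate : ∀ {x y s r C V T Z} →
    (𝟙 - x) * T ≈ (𝟙 - x) * (y * C) + V * (𝟙 - y) →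
    V ≈ 𝟙 + x * (s * T) →
    (𝟙 - x) * (𝟙 - x) * Z ≈
      (𝟙 - x) * (𝟙 - x * y) * C + V * ((𝟙 + r) * (𝟙 - x) - (𝟙 - x * y)) →
    C ≈ 𝟙 + x * (s * Z) →
    (𝟙 - x) * (denominator x y s r * C) ≈ (𝟙 - x) * numerator x y s r
  eliminate {x} {y} {s} {r} {C} {V} {T} {Z} T-eq V-eq Z-eq C-eq = begin
    (𝟙 - x) * (denominator x y s r * C)
      ≈⟨ solve 5 (λ x y s r C →
           let ‵1 = con (+ 1) in
           (‵1 :- x) :* ((‵1 :- ((‵1 :+ ‵1) :* (s :+ ‵1)) :* x
               :+ ((s :+ ‵1) :* (s :+ ‵1)) :* (x :* x) :+ s :* (x :* y)
               :- (s :* s :* (r :+ ‵1)) :* (x :* (x :* y))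
               :+ (s :* (r :* s :- ‵1)) :* (x :* (x :* (x :* y)))) :* C)
           := (‵1 :- x :- x :* s :* (‵1 :- y)) :* ((‵1 :- x) :* (‵1 :- x) :* C)
             :- (x :* s :* (‵1 :- x :- x :* s :* (‵1 :- y)) :* (‵1 :- x) :* (‵1 :- x :* y) :* C
               :+ (‵1 :- x) :* x :* x :* s :* s :* y
                   :* ((‵1 :+ r) :* (‵1 :- x) :- (‵1 :- x :* y)) :* C))
           refl x y s r C ⟩
    E * ((𝟙 - x) * (𝟙 - x) * C) - W
      ≈⟨ +-congʳ (*-congˡ C-eq′) ⟩
    E * ((𝟙 - x) * (𝟙 - x) + x * s * ((𝟙 - x) * (𝟙 - x * y) * C + V * H)) - W
      ≈⟨ solve 6 (λ x y s C V H →
           let ‵1 = con (+ 1) ; E = ‵1 :- x :- x :* s :* (‵1 :- y) in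
           E :* ((‵1 :- x) :* (‵1 :- x) :+ x :* s :* ((‵1 :- x) :* (‵1 :- x :* y) :* C :+ V :* H))
             :- (x :* s :* E :* (‵1 :- x) :* (‵1 :- x :* y) :* C
               :+ (‵1 :- x) :* x :* x :* s :* s :* y :* H :* C)
           := (E :* (‵1 :- x) :* (‵1 :- x) :+ x :* s :* (E :* V) :* H)
             :- (‵1 :- x) :* x :* x :* s :* s :* y :* H :* C)
           refl x y s C V H ⟩
    (E * (𝟙 - x) * (𝟙 - x) + x * s * (E * V) * H) - (𝟙 - x) * x * x * s * s * y * H * C
      ≈⟨ +-congʳ (+-congˡ (*-congʳ (*-congˡ E*V))) ⟩
    (E * (𝟙 - x) * (𝟙 - x) + x * s * ((𝟙 - x) * (𝟙 + s * x * y * C)) * H)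
      - (𝟙 - x) * x * x * s * s * y * H * C
      ≈⟨ solve 5 (λ x y s r C →
           let ‵1 = con (+ 1) ; E = ‵1 :- x :- x :* s :* (‵1 :- y)
               H = (‵1 :+ r) :* (‵1 :- x) :- (‵1 :- x :* y) in
           (E :* (‵1 :- x) :* (‵1 :- x) :+ x :* s :* ((‵1 :- x) :* (‵1 :+ s :* x :* y :* C)) :* H)
             :- (‵1 :- x) :* x :* x :* s :* s :* y :* H :* C
           := (‵1 :- x) :* (‵1 :+ (r :* s :- s :- (‵1 :+ ‵1)) :* x
                :- (r :* s :- ‵1) :* (x :* x) :+ s :* (x :* y)))
           refl x y s r C ⟩
    (𝟙 - x) * numerator x y s r ∎
    where
    -- `E` is the coefficient of V once T is gone, and `H` that of V in the Z-equation. `W` consists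
    -- of the terms in C that the substitutions for Z and E * V produce, so they cancel and leave
    -- the numerator.
    E H W : Carrier
    E = 𝟙 - x - x * s * (𝟙 - y)
    H = (𝟙 + r) * (𝟙 - x) - (𝟙 - x * y)
    W = x * s * E * (𝟙 - x) * (𝟙 - x * y) * C + (𝟙 - x) * x * x * s * s * y * H * C

    C-eq′ : (𝟙 - x) * (𝟙 - x) * C ≈
      (𝟙 - x) * (𝟙 - x) + x * s * ((𝟙 - x) * (𝟙 - x * y) * C + V * H)
    C-eq′ = begin
      (𝟙 - x) * (𝟙 - x) * C
        ≈⟨ *-congˡ C-eq ⟩
      (𝟙 - x) * (𝟙 - x) * (𝟙 + x * (s * Z))
        ≈⟨ solve 3 (λ x s Z → let ‵1 = con (+ 1) in
             (‵1 :- x) :* (‵1 :- x) :* (‵1 :+ x :* (s :* Z))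
             := (‵1 :- x) :* (‵1 :- x) :+ x :* s :* ((‵1 :- x) :* (‵1 :- x) :* Z))
             refl x s Z ⟩
      (𝟙 - x) * (𝟙 - x) + x * s * ((𝟙 - x) * (𝟙 - x) * Z)
        ≈⟨ +-congˡ (*-congˡ Z-eq) ⟩
      (𝟙 - x) * (𝟙 - x) + x * s * ((𝟙 - x) * (𝟙 - x * y) * C + V * H) ∎

    E*V : E * V ≈ (𝟙 - x) * (𝟙 + s * x * y * C)
    E*V = begin
      E * V
        ≈⟨ solve 4 (λ x y s V → let ‵1 = con (+ 1) in
             (‵1 :- x :- x :* s :* (‵1 :- y)) :* V
             := (‵1 :- x) :* V :- x :* s :* (V :* (‵1 :- y))) refl x y s V ⟩
      (𝟙 - x) * V - x * s * (V * (𝟙 - y))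
        ≈⟨ +-congʳ (*-congˡ V-eq) ⟩
      (𝟙 - x) * (𝟙 + x * (s * T)) - x * s * (V * (𝟙 - y))
        ≈⟨ solve 5 (λ x y s T V → let ‵1 = con (+ 1) in
             (‵1 :- x) :* (‵1 :+ x :* (s :* T)) :- x :* s :* (V :* (‵1 :- y))
             := (‵1 :- x) :+ x :* s :* ((‵1 :- x) :* T) :- x :* s :* (V :* (‵1 :- y)))
             refl x y s T V ⟩
      (𝟙 - x) + x * s * ((𝟙 - x) * T) - x * s * (V * (𝟙 - y))
        ≈⟨ +-congʳ (+-congˡ (*-congˡ T-eq)) ⟩
      (𝟙 - x) + x * s * ((𝟙 - x) * (y * C) + V * (𝟙 - y)) - x * s * (V * (𝟙 - y))
        ≈⟨ solve 5 (λ x y s C V → let ‵1 = con (+ 1) in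
             (‵1 :- x) :+ x :* s :* ((‵1 :- x) :* (y :* C) :+ V :* (‵1 :- y))
               :- x :* s :* (V :* (‵1 :- y))
             := (‵1 :- x) :* (‵1 :+ s :* x :* y :* C)) refl x y s C V ⟩
      (𝟙 - x) * (𝟙 + s * x * y * C) ∎

  -- V / (1 - x) is the fixed point of the affine recurrence for T, so T q is
  -- that fixed point plus a multiple of X q = x^q, and Z is a geometric sum.
  module Geometric
    (x V : Carrier) (X T Z : ℕ → Carrier)
    (X-zero : X 0 ≈ 𝟙) (X-suc : ∀ q → X (suc q) ≈ x * X q)
    (T-suc : ∀ q → T (suc q) ≈ x * T q + V)
    (Z-zero : Z 0 ≈ 𝟘) (Z-suc : ∀ q → Z (suc q) ≈ Z q + T q)
    where

    T-closed : ∀ q → (𝟙 - x) * T q ≈ (𝟙 - x) * (X q * T 0) + V * (𝟙 - X q)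
    T-closed zero = begin
      (𝟙 - x) * T 0
        ≈⟨ solve 3 (λ x T V → (con (+ 1) :- x) :* T
             := (con (+ 1) :- x) :* (con (+ 1) :* T) :+ V :* (con (+ 1) :- con (+ 1)))
             refl x (T 0) V ⟩
      (𝟙 - x) * (𝟙 * T 0) + V * (𝟙 - 𝟙)
        ≈⟨ +-cong (*-congˡ (*-congʳ X-zero)) (*-congˡ (+-congˡ (-‿cong X-zero))) ⟨
      (𝟙 - x) * (X 0 * T 0) + V * (𝟙 - X 0) ∎
    T-closed (suc q) = begin
      (𝟙 - x) * T (suc q)
        ≈⟨ *-congˡ (T-suc q) ⟩
      (𝟙 - x) * (x * T q + V)
        ≈⟨ solve 3 (λ x T V → (con (+ 1) :- x) :* (x :* T :+ V)
             := x :* ((con (+ 1) :- x) :* T) :+ (con (+ 1) :- x) :* V)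
             refl x (T q) V ⟩
      x * ((𝟙 - x) * T q) + (𝟙 - x) * V
        ≈⟨ +-congʳ (*-congˡ (T-closed q)) ⟩
      x * ((𝟙 - x) * (X q * T 0) + V * (𝟙 - X q)) + (𝟙 - x) * V
        ≈⟨ solve 4 (λ x X C V →
             x :* ((con (+ 1) :- x) :* (X :* C) :+ V :* (con (+ 1) :- X)) :+ (con (+ 1) :- x) :* V
             := (con (+ 1) :- x) :* ((x :* X) :* C) :+ V :* (con (+ 1) :- x :* X))
             refl x (X q) (T 0) V ⟩
      (𝟙 - x) * ((x * X q) * T 0) + V * (𝟙 - x * X q)
        ≈⟨ +-cong (*-congˡ (*-congʳ (X-suc q))) (*-congˡ (+-congˡ (-‿cong (X-suc q)))) ⟨
      (𝟙 - x) * (X (suc q) * T 0) + V * (𝟙 - X (suc q)) ∎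

    -- This is `T-closed` summed over the classes below q; the second factor 1 - x clears the
    -- denominator of the geometric sum of the X i.
    Z-closed : ∀ q → (𝟙 - x) * (𝟙 - x) * Z q ≈
      (𝟙 - x) * (𝟙 - X q) * T 0 + V * (ι (+ q) * (𝟙 - x) - (𝟙 - X q))
    Z-closed zero = begin
      (𝟙 - x) * (𝟙 - x) * Z 0
        ≈⟨ *-congˡ Z-zero ⟩
      (𝟙 - x) * (𝟙 - x) * 𝟘
        ≈⟨ solve 3 (λ x T V → (con (+ 1) :- x) :* (con (+ 1) :- x) :* con (+ 0)
             := (con (+ 1) :- x) :* (con (+ 1) :- con (+ 1)) :* T
               :+ V :* (con (+ 0) :* (con (+ 1) :- x) :- (con (+ 1) :- con (+ 1))))
             refl x (T 0) V ⟩
      (𝟙 - x) * (𝟙 - 𝟙) * T 0 + V * (𝟘 * (𝟙 - x) - (𝟙 - 𝟙))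
        ≈⟨ +-cong (*-congʳ (*-congˡ (+-congˡ (-‿cong X-zero))))
             (*-congˡ (+-congˡ (-‿cong (+-congˡ (-‿cong X-zero))))) ⟨
      (𝟙 - x) * (𝟙 - X 0) * T 0 + V * (𝟘 * (𝟙 - x) - (𝟙 - X 0)) ∎
    Z-closed (suc q) = begin
      (𝟙 - x) * (𝟙 - x) * Z (suc q)
        ≈⟨ *-congˡ (Z-suc q) ⟩
      (𝟙 - x) * (𝟙 - x) * (Z q + T q)
        ≈⟨ solve 3 (λ x Z T → (con (+ 1) :- x) :* (con (+ 1) :- x) :* (Z :+ T)
             := (con (+ 1) :- x) :* (con (+ 1) :- x) :* Z
               :+ (con (+ 1) :- x) :* ((con (+ 1) :- x) :* T))
             refl x (Z q) (T q) ⟩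
      (𝟙 - x) * (𝟙 - x) * Z q + (𝟙 - x) * ((𝟙 - x) * T q)
        ≈⟨ +-cong (Z-closed q) (*-congˡ (T-closed q)) ⟩
      ((𝟙 - x) * (𝟙 - X q) * T 0 + V * (ι (+ q) * (𝟙 - x) - (𝟙 - X q)))
        + (𝟙 - x) * ((𝟙 - x) * (X q * T 0) + V * (𝟙 - X q))
        ≈⟨ solve 5 (λ x X C V q →
             ((con (+ 1) :- x) :* (con (+ 1) :- X) :* C
               :+ V :* (q :* (con (+ 1) :- x) :- (con (+ 1) :- X)))
               :+ (con (+ 1) :- x) :* ((con (+ 1) :- x) :* (X :* C) :+ V :* (con (+ 1) :- X))
             := (con (+ 1) :- x) :* (con (+ 1) :- x :* X) :* C
               :+ V :* ((con (+ 1) :+ q) :* (con (+ 1) :- x) :- (con (+ 1) :- x :* X)))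
             refl x (X q) (T 0) V (ι (+ q)) ⟩
      (𝟙 - x) * (𝟙 - x * X q) * T 0 + V * ((𝟙 + ι (+ q)) * (𝟙 - x) - (𝟙 - x * X q))
        ≈⟨ +-cong (*-congʳ (*-congˡ (+-congˡ (-‿cong (X-suc q)))))
             (*-congˡ (+-cong (*-congʳ (+-homo (+ 1) (+ q)))
               (-‿cong (+-congˡ (-‿cong (X-suc q)))))) ⟨
      (𝟙 - x) * (𝟙 - X (suc q)) * T 0
        + V * (ι (+ suc q) * (𝟙 - x) - (𝟙 - X (suc q))) ∎

    generatingFunction : ∀ s r → V ≈ 𝟙 + x * (s * T r) → T 0 ≈ 𝟙 + x * (s * Z (suc r)) →
      (𝟙 - x) * (denominator x (X r) s (ι (+ r)) * T 0) ≈
      (𝟙 - x) * numerator x (X r) s (ι (+ r))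
    generatingFunction s r V-eq = eliminate (T-closed r) V-eq (begin
      (𝟙 - x) * (𝟙 - x) * Z (suc r)
        ≈⟨ Z-closed (suc r) ⟩
      (𝟙 - x) * (𝟙 - X (suc r)) * T 0 + V * (ι (+ suc r) * (𝟙 - x) - (𝟙 - X (suc r)))
        ≈⟨ +-cong (*-congʳ (*-congˡ (+-congˡ (-‿cong (X-suc r)))))
             (*-congˡ (+-cong (*-congʳ (+-homo (+ 1) (+ r)))
               (-‿cong (+-congˡ (-‿cong (X-suc r)))))) ⟩
      (𝟙 - x) * (𝟙 - x * X r) * T 0 + V * ((𝟙 + ι (+ r)) * (𝟙 - x) - (𝟙 - x * X r)) ∎)

-- Paths of the Markov chain

open ≡ using (refl; sym; trans; cong; cong₂; subst; subst₂; module ≡-Reasoning)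

module _ {A B : Set} where

  length-concatMap : (f : A → List B) → ∀ xs →
    length (concatMap f xs) ≡ ℕ.sum (List.map (length ∘ f) xs)
  length-concatMap f []       = refl
  length-concatMap f (x ∷ xs) =
    trans (List.length-++ (f x)) (cong (length (f x) ℕ.+_) (length-concatMap f xs))

applyUpTo-+ : ∀ {A : Set} (f : ℕ → A) m n →
  applyUpTo f (m ℕ.+ n) ≡ applyUpTo f m ++ applyUpTo (f ∘ (m ℕ.+_)) n
applyUpTo-+ f zero    n = refl
applyUpTo-+ f (suc m) n = cong (f 0 ∷_) (applyUpTo-+ (f ∘ suc) m n)

sum-applyUpTo-+ : ∀ f m n → ℕ.sum (applyUpTo f (m ℕ.+ n)) ≡
  ℕ.sum (applyUpTo f m) ℕ.+ ℕ.sum (applyUpTo (f ∘ (m ℕ.+_)) n)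
sum-applyUpTo-+ f m n = trans (cong ℕ.sum (applyUpTo-+ f m n)) (ℕ.sum-++ (applyUpTo f m) _)

sum-applyUpTo-suc : ∀ f m → ℕ.sum (applyUpTo f (suc m)) ≡ ℕ.sum (applyUpTo f m) ℕ.+ f m
sum-applyUpTo-suc f m = trans (cong ℕ.sum (sym (List.applyUpTo-∷ʳ f m)))
  (trans (ℕ.sum-++ (applyUpTo f m) [ f m ]) (cong (ℕ.sum (applyUpTo f m) ℕ.+_) (ℕ.+-identityʳ (f m))))

sum-applyUpTo-const : ∀ {f a} n → (∀ {i} → i ℕ.< n → f i ≡ a) → ℕ.sum (applyUpTo f n) ≡ n ℕ.* a
sum-applyUpTo-const zero    f≡a = refl
sum-applyUpTo-const (suc n) f≡a = cong₂ ℕ._+_ (f≡a z<s) (sum-applyUpTo-const n (f≡a ∘ s<s))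

-- Windows of length s + e, each shifted by s.  A state is the position of the
-- selected coordinate relative to the start of its window.
module Paths (s e : ℕ) where

  -- The next window selects freely if it has left the current coordinate p
  -- behind, and otherwise keeps p or selects one of its s new coordinates.
  Step : ℕ → ℕ → Set
  Step p q = q ℕ.< s ℕ.+ e × (p ℕ.< s ⊎ p ≡ s ℕ.+ q ⊎ e ℕ.≤ q)

  next : ℕ → List ℕ
  next p with p ℕ.<? s
  -- The order e + s lets sums over these positions split into the e overlapping ones and the s new
  -- ones, that is, `renewals`.
  ... | yes _ = upTo (e ℕ.+ s)
  ... | no  _ = (p ℕ.∸ s) ∷ applyUpTo (e ℕ.+_) s

  next⁺ : ∀ {p q} → Step p q → q ∈ˡ next p
  next⁺ {p} {q} (q<s+e , step) with p ℕ.<? s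
  ... | yes _ = ∈-upTo⁺ (subst (q ℕ.<_) (ℕ.+-comm s e) q<s+e)
  next⁺ (q<s+e , inj₁ p<s) | no p≮s = contradiction p<s p≮s
  next⁺ {q = q} (q<s+e , inj₂ (inj₁ refl)) | no p≮s = here (sym (ℕ.m+n∸m≡n s q))
  next⁺ {q = q} (q<s+e , inj₂ (inj₂ e≤q)) | no p≮s =
    there (subst (_∈ˡ applyUpTo (e ℕ.+_) s) (ℕ.m+[n∸m]≡n e≤q)
      (∈-applyUpTo⁺ (e ℕ.+_) (ℕ.+-cancelˡ-< e _ _
        (subst (ℕ._< e ℕ.+ s) (sym (ℕ.m+[n∸m]≡n e≤q)) (subst (q ℕ.<_) (ℕ.+-comm s e) q<s+e)))))

  next⁻ : ∀ {p q} → p ℕ.< s ℕ.+ e → q ∈ˡ next p → Step p q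
  next⁻ {p} {q} p<s+e q∈ with p ℕ.<? s
  ... | yes p<s = subst (q ℕ.<_) (ℕ.+-comm e s) (∈-upTo⁻ q∈) , inj₁ p<s
  next⁻ {p} p<s+e (here refl) | no p≮s =
      ℕ.≤-<-trans (ℕ.m∸n≤m p s) p<s+e
    , inj₂ (inj₁ (sym (ℕ.m+[n∸m]≡n (ℕ.≮⇒≥ p≮s))))
  next⁻ p<s+e (there q∈) | no p≮s with ∈-applyUpTo⁻ (e ℕ.+_) q∈
  ... | i , i<s , refl =
      subst (e ℕ.+ i ℕ.<_) (ℕ.+-comm e s) (ℕ.+-monoʳ-< e i<s)
    , inj₂ (inj₂ (ℕ.m≤m+n e i))

  -- The kept position p - s lies below e because p lies in its window, while the new positions
  -- start at e.
  next-unique : ∀ {p} → p ℕ.< s ℕ.+ e → Unique (next p)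
  next-unique {p} p<s+e with p ℕ.<? s
  ... | yes _ = Unique.upTo⁺ (e ℕ.+ s)
  ... | no p≮s = All.applyUpTo⁺₂ (e ℕ.+_) s p∸s≢
               ∷ Unique.applyUpTo⁺₁ (e ℕ.+_) s λ i<j _ → ℕ.<⇒≢ (ℕ.+-monoʳ-< e i<j)
    where
    p∸s≢ : ∀ i → ¬ p ℕ.∸ s ≡ e ℕ.+ i
    p∸s≢ i eq = ℕ.<⇒≢ (ℕ.<-≤-trans p∸s<e (ℕ.m≤m+n e i)) eq
      where
      p∸s<e : p ℕ.∸ s ℕ.< e
      p∸s<e = ℕ.+-cancelˡ-< s _ _ (subst (ℕ._< s ℕ.+ e) (sym (ℕ.m+[n∸m]≡n (ℕ.≮⇒≥ p≮s))) p<s+e)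

  paths : ∀ n → ℕ → List (Vec ℕ n)
  paths zero    p = [ [] ]
  paths (suc n) p = concatMap (λ q → List.map (q ∷_) (paths n q)) (next p)

  paths⁺ : ∀ {n p} {v : Vec ℕ n} → Linked Step (p ∷ v) → v ∈ˡ paths n p
  paths⁺ [-]           = here refl
  paths⁺ {suc n} {v = q ∷ v} (step ∷ steps) =
    ∈-concatMap⁺ (λ q → List.map (q ∷_) (paths n q))
      (Any.map (λ { refl → ∈-map⁺ (q ∷_) (paths⁺ steps) }) (next⁺ step))

  paths⁻ : ∀ {n p} {v : Vec ℕ n} → p ℕ.< s ℕ.+ e → v ∈ˡ paths n p → Linked Step (p ∷ v)
  paths⁻ {zero}  {v = []} p<s+e v∈ = [-]
  paths⁻ {suc n} {p} p<s+e v∈ with find (∈-concatMap⁻ (λ q → List.map (q ∷_) (paths n q)) {xs = next p} v∈)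
  ... | q , q∈ , v∈′ with ∈-map⁻ (q ∷_) v∈′
  ... | w , w∈ , refl = let step = next⁻ p<s+e q∈ in step ∷ paths⁻ (proj₁ step) w∈

  paths-unique : ∀ n {p} → p ℕ.< s ℕ.+ e → Unique (paths n p)
  paths-unique zero    p<s+e = [] ∷ []
  paths-unique (suc n) {p} p<s+e = Unique.concat⁺
    (All.map⁺ (All.tabulate λ q∈ →
      Unique.map⁺ Vec.∷-injectiveʳ (paths-unique n (proj₁ (next⁻ p<s+e q∈)))))
    (AllPairs.map⁺ (AllPairs.map disjoint (next-unique p<s+e)))
    where
    disjoint : ∀ {q q′} → ¬ q ≡ q′ → ∀ {v} →
      ¬ (v ∈ˡ List.map (q ∷_) (paths n q) × v ∈ˡ List.map (q′ ∷_) (paths n q′))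
    disjoint {q} {q′} q≢q′ (v∈ , v∈′) with ∈-map⁻ (q ∷_) v∈ | ∈-map⁻ (q′ ∷_) v∈′
    ... | _ , _ , refl | _ , _ , eq = q≢q′ (Vec.∷-injectiveˡ eq)

  count : ℕ → ℕ → ℕ
  count n p = length (paths n p)

  -- Continuations of length n after the selection of a coordinate that is new
  -- in its window.
  renewals : ℕ → ℕ
  renewals n = ℕ.sum (applyUpTo (count n ∘ (e ℕ.+_)) s)

  count-suc : ∀ n p → count (suc n) p ≡ ℕ.sum (List.map (count n) (next p))
  count-suc n p = trans (length-concatMap _ (next p))
    (cong ℕ.sum (List.map-cong (λ q → List.length-map (q ∷_) (paths n q)) (next p)))

  count-low : ∀ n {p} → p ℕ.< s → count (suc n) p ≡ ℕ.sum (applyUpTo (count n) (e ℕ.+ s))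
  count-low n {p} p<s with count-suc n p
  ... | eq with p ℕ.<? s
  ... | yes _  = trans eq (cong ℕ.sum (List.map-upTo (count n) (e ℕ.+ s)))
  ... | no p≮s = contradiction p<s p≮s

  count-low≡ : ∀ n {p q} → p ℕ.< s → q ℕ.< s → count n p ≡ count n q
  count-low≡ zero    p<s q<s = refl
  count-low≡ (suc n) p<s q<s = trans (count-low n p<s) (sym (count-low n q<s))

  count-high : ∀ n p → count (suc n) (s ℕ.+ p) ≡ count n p ℕ.+ renewals n
  count-high n p with count-suc n (s ℕ.+ p)
  ... | eq with s ℕ.+ p ℕ.<? s
  ... | yes s+p<s = contradiction s+p<s (ℕ.m+n≮m s p)
  ... | no  _     = trans eq (cong₂ (λ q qs → count n q ℕ.+ ℕ.sum qs)
                      (ℕ.m+n∸m≡n s p) (List.map-applyUpTo (e ℕ.+_) (count n) s))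

  -- Short overlaps: a window meets only its two neighbours.
  module _ (0<s : 0 ℕ.< s) (e≤s : e ℕ.≤ s) where

    -- Since e ≤ s, each of the e overlapping positions is left behind by the following window and
    -- so counts like position 0.
    count-split : ∀ n → count (suc n) 0 ≡ e ℕ.* count n 0 ℕ.+ renewals n
    count-split n = begin
      count (suc n) 0                               ≡⟨ count-low n 0<s ⟩
      ℕ.sum (applyUpTo (count n) (e ℕ.+ s))           ≡⟨ sum-applyUpTo-+ (count n) e s ⟩
      ℕ.sum (applyUpTo (count n) e) ℕ.+ renewals n
        ≡⟨ cong (ℕ._+ renewals n) (sum-applyUpTo-const e λ i<e →
             count-low≡ n (ℕ.<-≤-trans i<e e≤s) 0<s) ⟩
      e ℕ.* count n 0 ℕ.+ renewals n                ∎
      where open ≡-Reasoning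

    -- Now the window is cut after its first s positions. Those impose nothing further; a remaining
    -- one, s + i with i < e, is renewed or becomes i, and i < s again counts like 0.
    count-split₂ : ∀ n → count (suc (suc n)) 0 ≡
      s ℕ.* count (suc n) 0 ℕ.+ e ℕ.* (count n 0 ℕ.+ renewals n)
    count-split₂ n = begin
      count (suc (suc n)) 0
        ≡⟨ count-low (suc n) 0<s ⟩
      ℕ.sum (applyUpTo (count (suc n)) (e ℕ.+ s))
        ≡⟨ cong (ℕ.sum ∘ applyUpTo (count (suc n))) (ℕ.+-comm e s) ⟩
      ℕ.sum (applyUpTo (count (suc n)) (s ℕ.+ e))
        ≡⟨ sum-applyUpTo-+ (count (suc n)) s e ⟩
      ℕ.sum (applyUpTo (count (suc n)) s) ℕ.+ ℕ.sum (applyUpTo (count (suc n) ∘ (s ℕ.+_)) e)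
        ≡⟨ cong₂ ℕ._+_
             (sum-applyUpTo-const s λ i<s → count-low≡ (suc n) i<s 0<s)
             (sum-applyUpTo-const e λ {i} i<e → trans (count-high n i)
               (cong (ℕ._+ renewals n) (count-low≡ n (ℕ.<-≤-trans i<e e≤s) 0<s))) ⟩
      s ℕ.* count (suc n) 0 ℕ.+ e ℕ.* (count n 0 ℕ.+ renewals n) ∎
      where open ≡-Reasoning

  module _ (0<s : 0 ℕ.< s) where

    count-class : ∀ n q {i} → i ℕ.< s → count n (s ℕ.* q ℕ.+ i) ≡ count n (s ℕ.* q)
    count-class zero    q       i<s = refl
    count-class (suc n) zero    i<s rewrite ℕ.*-zeroʳ s = count-low≡ (suc n) i<s 0<s
    count-class (suc n) (suc q) {i} i<s = begin
      count (suc n) (s ℕ.* suc q ℕ.+ i)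
        ≡⟨ cong (count (suc n)) (trans (cong (ℕ._+ i) (ℕ.*-suc s q)) (ℕ.+-assoc s (s ℕ.* q) i)) ⟩
      count (suc n) (s ℕ.+ (s ℕ.* q ℕ.+ i))     ≡⟨ count-high n (s ℕ.* q ℕ.+ i) ⟩
      count n (s ℕ.* q ℕ.+ i) ℕ.+ renewals n    ≡⟨ cong (ℕ._+ renewals n) (count-class n q i<s) ⟩
      count n (s ℕ.* q) ℕ.+ renewals n          ≡⟨ count-high n (s ℕ.* q) ⟨
      count (suc n) (s ℕ.+ s ℕ.* q)             ≡⟨ cong (count (suc n)) (ℕ.*-suc s q) ⟨
      count (suc n) (s ℕ.* suc q)               ∎
      where open ≡-Reasoning

    sum-classes : ∀ n q → ℕ.sum (applyUpTo (count n) (s ℕ.* q)) ≡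
      s ℕ.* ℕ.sum (applyUpTo (λ i → count n (s ℕ.* i)) q)
    sum-classes n zero    rewrite ℕ.*-zeroʳ s = refl
    sum-classes n (suc q) = begin
      ℕ.sum (applyUpTo (count n) (s ℕ.* suc q))
        ≡⟨ cong (ℕ.sum ∘ applyUpTo (count n)) (trans (ℕ.*-suc s q) (ℕ.+-comm s (s ℕ.* q))) ⟩
      ℕ.sum (applyUpTo (count n) (s ℕ.* q ℕ.+ s))
        ≡⟨ sum-applyUpTo-+ (count n) (s ℕ.* q) s ⟩
      ℕ.sum (applyUpTo (count n) (s ℕ.* q)) ℕ.+ ℕ.sum (applyUpTo (count n ∘ (s ℕ.* q ℕ.+_)) s)
        ≡⟨ cong₂ ℕ._+_ (sum-classes n q) (sum-applyUpTo-const s (count-class n q)) ⟩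
      s ℕ.* ℕ.sum (applyUpTo c q) ℕ.+ s ℕ.* c q
        ≡⟨ ℕ.*-distribˡ-+ s (ℕ.sum (applyUpTo c q)) (c q) ⟨
      s ℕ.* (ℕ.sum (applyUpTo c q) ℕ.+ c q)
        ≡⟨ cong (s ℕ.*_) (sum-applyUpTo-suc c q) ⟨
      s ℕ.* ℕ.sum (applyUpTo c (suc q)) ∎
      where
      open ≡-Reasoning
      c : ℕ → ℕ
      c i = count n (s ℕ.* i)

-- Paths as selections in sliding windows

lookup-injective : ∀ {A : Set} {xs : List A} → Unique xs →
  ∀ {i j} → List.lookup xs i ≡ List.lookup xs j → i ≡ j
lookup-injective (x∉ ∷ _)  {zero}  {zero}  eq = refl
lookup-injective (x∉ ∷ _)  {zero}  {suc j} eq = contradiction eq (All.lookup x∉ (∈-lookup j))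
lookup-injective (x∉ ∷ _)  {suc i} {zero}  eq = contradiction (sym eq) (All.lookup x∉ (∈-lookup i))
lookup-injective (_ ∷ xs!) {suc i} {suc j} eq = cong suc (lookup-injective xs! eq)

linked-tabulate : ∀ {A : Set} {R : A → A → Set} {n} (g : Fin (suc n) → A) →
  (∀ i j → toℕ j ≡ suc (toℕ i) → R (g i) (g j)) → Linked R (tabulate g)
linked-tabulate {n = zero}  g adjacent = [-]
linked-tabulate {n = suc n} g adjacent =
  adjacent zero (suc zero) refl ∷ linked-tabulate (g ∘ suc) λ i j → adjacent (suc i) (suc j) ∘ cong suc

-- Height functions that realize a path

module Heights (s e : ℕ) where

  open Paths s e

  step-bound : ∀ {n p} {v : Vec ℕ n} → Linked Step (p ∷ v) → ∀ i → lookup v i ℕ.< s ℕ.+ e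
  step-bound {v = _ ∷ _} ((q<k , _) ∷ _) zero    = q<k
  step-bound {v = _ ∷ _} (_ ∷ steps)     (suc i) = step-bound steps i

  record State : Set where
    constructor state
    field
      start position height : ℕ

  open State public

  -- The height goes down when the selected coordinate leaves the window and up
  -- when it is superseded by a new one; counting the drops that are still to
  -- come keeps it a natural number.
  drops : ∀ {n p} {v : Vec ℕ n} → Linked Step (p ∷ v) → ℕ
  drops [-]                               = 0
  drops {v = _ ∷ _} ((_ , inj₁ _) ∷ rest) = suc (drops rest)
  drops {v = _ ∷ _} ((_ , inj₂ _) ∷ rest) = drops rest

  rises : ∀ {p q} → Step p q → ℕ
  rises (_ , inj₁ _)        = 0
  rises (_ , inj₂ (inj₁ _)) = 0
  rises (_ , inj₂ (inj₂ _)) = 1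

  -- `w` is the start of the current window and `u` the number of rises so far. The height, rises so
  -- far plus drops to come, thus decreases by one at a drop and increases by one at a rise.
  trace : ∀ {n p} {v : Vec ℕ n} → ℕ → ℕ → Linked Step (p ∷ v) → Vec State (suc n)
  trace {p = p} w u steps@[-]                   = state w (w ℕ.+ p) (u ℕ.+ drops steps) ∷ []
  trace {p = p} {_ ∷ _} w u steps@(step ∷ rest) =
    state w (w ℕ.+ p) (u ℕ.+ drops steps) ∷ trace (w ℕ.+ s) (rises step ℕ.+ u) rest

  -- x belongs to the earlier window. `falls` treats a later choice already visible there, `climbs`
  -- an earlier choice still visible later. Monotone starts and positions pass either visibility
  -- condition on to an intermediate state, which makes the relation transitive.
  record _⇝_ (x y : State) : Set where
    field
      start-≤    : start x ℕ.≤ start y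
      position-≤ : position x ℕ.≤ position y
      falls      : position y ℕ.< start x ℕ.+ (s ℕ.+ e) →
                   (position x ≡ position y × height x ≡ height y) ⊎ height y ℕ.< height x
      climbs     : start y ℕ.≤ position x →
                   (position x ≡ position y × height x ≡ height y) ⊎ height x ℕ.< height y

  open _⇝_ public

  ⇝-trans : Transitive _⇝_
  ⇝-trans {x} {y} {z} x⇝y y⇝z = record
    { start-≤    = ℕ.≤-trans (start-≤ x⇝y) (start-≤ y⇝z)
    ; position-≤ = ℕ.≤-trans (position-≤ x⇝y) (position-≤ y⇝z)
    ; falls      = λ z<k → both-fall (falls x⇝y (ℕ.≤-<-trans (position-≤ y⇝z) z<k))
        (falls y⇝z (ℕ.<-≤-trans z<k (ℕ.+-monoˡ-≤ (s ℕ.+ e) (start-≤ x⇝y))))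
    ; climbs     = λ z≤x → both-climb (climbs x⇝y (ℕ.≤-trans (start-≤ y⇝z) z≤x))
        (climbs y⇝z (ℕ.≤-trans z≤x (position-≤ x⇝y)))
    }
    where
    both-fall : (position x ≡ position y × height x ≡ height y) ⊎ height y ℕ.< height x →
                (position y ≡ position z × height y ≡ height z) ⊎ height z ℕ.< height y →
                (position x ≡ position z × height x ≡ height z) ⊎ height z ℕ.< height x
    both-fall (inj₁ (p , h)) (inj₁ (p′ , h′)) = inj₁ (trans p p′ , trans h h′)
    both-fall (inj₁ (p , h)) (inj₂ h′)        = inj₂ (subst (height z ℕ.<_) (sym h) h′)
    both-fall (inj₂ h)       (inj₁ (p′ , h′)) = inj₂ (subst (ℕ._< height x) h′ h)
    both-fall (inj₂ h)       (inj₂ h′)        = inj₂ (ℕ.<-trans h′ h)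
    both-climb : (position x ≡ position y × height x ≡ height y) ⊎ height x ℕ.< height y →
                 (position y ≡ position z × height y ≡ height z) ⊎ height y ℕ.< height z →
                 (position x ≡ position z × height x ≡ height z) ⊎ height x ℕ.< height z
    both-climb (inj₁ (p , h)) (inj₁ (p′ , h′)) = inj₁ (trans p p′ , trans h h′)
    both-climb (inj₁ (p , h)) (inj₂ h′)        = inj₂ (subst (ℕ._< height z) (sym h) h′)
    both-climb (inj₂ h)       (inj₁ (p′ , h′)) = inj₂ (subst (height x ℕ.<_) h′ h)
    both-climb (inj₂ h)       (inj₂ h′)        = inj₂ (ℕ.<-trans h h′)

  -- After a drop the old coordinate lies before the new window, so `climbs` is vacuous; after a
  -- rise the new coordinate lies beyond the old window, so `falls` is vacuous. Each kind of step
  -- thus serves the one comparison that matters.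
  step⇝ : ∀ {n p q} {v : Vec ℕ n} w u → p ℕ.< s ℕ.+ e → (step : Step p q) (rest : Linked Step (q ∷ v)) →
    state w (w ℕ.+ p) (u ℕ.+ drops (step ∷ rest)) ⇝
    state (w ℕ.+ s) (w ℕ.+ s ℕ.+ q) (rises step ℕ.+ u ℕ.+ drops rest)
  step⇝ {p = p} {q} w u p<k (_ , inj₁ p<s) rest = record
    { start-≤    = ℕ.m≤m+n w s
    ; position-≤ = ℕ.≤-trans (ℕ.+-monoʳ-≤ w (ℕ.<⇒≤ p<s)) (ℕ.m≤m+n (w ℕ.+ s) q)
    ; falls      = λ _ → inj₂ (ℕ.+-monoʳ-< u ℕ.≤-refl)
    ; climbs     = λ s≤p → contradiction p<s (ℕ.≤⇒≯ (ℕ.+-cancelˡ-≤ w _ _ s≤p))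
    }
  step⇝ {q = q} w u p<k (_ , inj₂ (inj₁ refl)) rest = record
    { start-≤    = ℕ.m≤m+n w s
    ; position-≤ = ℕ.≤-reflexive (sym (ℕ.+-assoc w s q))
    ; falls      = λ _ → inj₁ (sym (ℕ.+-assoc w s q) , refl)
    ; climbs     = λ _ → inj₁ (sym (ℕ.+-assoc w s q) , refl)
    }
  step⇝ {p = p} {q} w u p<k (_ , inj₂ (inj₂ e≤q)) rest = record
    { start-≤    = ℕ.m≤m+n w s
    ; position-≤ = subst (w ℕ.+ p ℕ.≤_) (sym (ℕ.+-assoc w s q))
                     (ℕ.+-monoʳ-≤ w (ℕ.≤-trans (ℕ.<⇒≤ p<k) (ℕ.+-monoʳ-≤ s e≤q)))
    ; falls      = λ q<e → contradiction e≤q (ℕ.<⇒≱ (ℕ.+-cancelˡ-< s _ _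
                     (ℕ.+-cancelˡ-< w _ _ (subst (ℕ._< w ℕ.+ (s ℕ.+ e)) (ℕ.+-assoc w s q) q<e))))
    ; climbs     = λ _ → inj₂ ℕ.≤-refl
    }

  trace-linked : ∀ {n p} {v : Vec ℕ n} w u → p ℕ.< s ℕ.+ e →
    (steps : Linked Step (p ∷ v)) → Linked _⇝_ (trace w u steps)
  trace-linked w u p<k [-] = [-]
  trace-linked {v = _ ∷ _} w u p<k (step ∷ [-]) = step⇝ w u p<k step [-] ∷ [-]
  trace-linked {v = _ ∷ _ ∷ _} w u p<k (step ∷ rest@(_ ∷ _)) =
    step⇝ w u p<k step rest ∷ trace-linked (w ℕ.+ s) _ (proj₁ step) rest

  trace-lookup : ∀ {n p} {v : Vec ℕ n} w u (steps : Linked Step (p ∷ v)) i →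
    start (lookup (trace w u steps) i) ≡ w ℕ.+ s ℕ.* toℕ i ×
    position (lookup (trace w u steps) i) ≡ w ℕ.+ s ℕ.* toℕ i ℕ.+ lookup (p ∷ v) i
  trace-lookup w u [-] zero rewrite ℕ.*-zeroʳ s | ℕ.+-identityʳ w = refl , refl
  trace-lookup {v = _ ∷ _} w u (_ ∷ _) zero rewrite ℕ.*-zeroʳ s | ℕ.+-identityʳ w = refl , refl
  trace-lookup {v = _ ∷ _} w u (step ∷ rest) (suc i)
    with trace-lookup (w ℕ.+ s) (rises step ℕ.+ u) rest i
  ... | start≡ , position≡ rewrite ℕ.*-suc s (toℕ i) | sym (ℕ.+-assoc w s (s ℕ.* toℕ i)) =
    start≡ , position≡

-- The bijection between paths and selections

module Windows {c ℓ₁ ℓ₂ ℓ₃} (F : OrderedField c ℓ₁ ℓ₂ ℓ₃) (s e : ℕ) (0<s : 0 ℕ.< s) (n : ℕ) where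

  open OrderedField F using (1#)
  open OrderedFieldProperties F using (_×ᶠ_; ×ᶠ-mono-<; <-asym)
  open Polytopes F
  open SumsOfSimplices F
  open Paths s e
  open Heights s e

  private
    k : ℕ
    k = s ℕ.+ e

    window : Fin (suc n) → Fin (dim (suc n) k s) → Set
    window = block (suc n) k s

    0<k : 0 ℕ.< k
    0<k = ℕ.<-≤-trans 0<s (ℕ.m≤m+n s e)

  position< : ∀ (i : Fin (suc n)) {p} → p ℕ.< k → s ℕ.* toℕ i ℕ.+ p ℕ.< dim (suc n) k s
  position< i p<k = ℕ.+-mono-≤-< (ℕ.*-monoʳ-≤ s (Fin.toℕ≤pred[n] i)) p<k

  module _ {v : Vec ℕ (suc n)} (steps : Linked Step (0 ∷ v)) where

    chosen : Vector (Fin (dim (suc n) k s)) (suc n)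
    chosen i = fromℕ< (position< i (step-bound steps i))

    toℕ-chosen : ∀ i → toℕ (chosen i) ≡ s ℕ.* toℕ i ℕ.+ lookup v i
    toℕ-chosen i = Fin.toℕ-fromℕ< (position< i (step-bound steps i))

  module _ {v : Vec ℕ (suc n)} (steps : Linked Step (0 ∷ v)) where

    private
      states : ∀ {v : Vec ℕ (suc n)} → Linked Step (0 ∷ v) → Vec State (suc n)
      -- The fictitious initial position 0 belongs to no window, so the trace starts at the first
      -- entry of the path.
      states {_ ∷ _} (_ ∷ rest) = trace 0 0 rest

      states-linked : ∀ {v : Vec ℕ (suc n)} (steps : Linked Step (0 ∷ v)) → Linked _⇝_ (states steps)
      states-linked {_ ∷ _} (step ∷ rest) = trace-linked 0 0 (proj₁ step) rest

      states-lookup : ∀ {v : Vec ℕ (suc n)} (steps : Linked Step (0 ∷ v)) i →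
        start (lookup (states steps) i) ≡ s ℕ.* toℕ i ×
        position (lookup (states steps) i) ≡ s ℕ.* toℕ i ℕ.+ lookup v i
      states-lookup {_ ∷ _} (_ ∷ rest) = trace-lookup 0 0 rest

      at : Fin (suc n) → State
      at = lookup (states steps)

      f : Vector (Fin (dim (suc n) k s)) (suc n)
      f = chosen steps

      start-at : ∀ i → start (at i) ≡ s ℕ.* toℕ i
      start-at i = proj₁ (states-lookup steps i)

      position-at : ∀ i → position (at i) ≡ toℕ (f i)
      position-at i = trans (proj₂ (states-lookup steps i)) (sym (toℕ-chosen steps i))

      at⇝ : ∀ {i j} → i Fin.< j → at i ⇝ at j
      at⇝ i<j = Linked.lookup⁺ ⇝-trans (states-linked steps) i<j

      chosen∈ : ∀ i → window i (f i)
      chosen∈ i rewrite toℕ-chosen steps i =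
        ℕ.m≤m+n (s ℕ.* toℕ i) _ , ℕ.+-monoʳ-< (s ℕ.* toℕ i) (step-bound steps i)

      starts≤ : ∀ i j → window i (f j) → start (at i) ℕ.≤ position (at j)
      starts≤ i j (lo , _) rewrite start-at i | position-at j = lo

      ends> : ∀ i j → window i (f j) → position (at j) ℕ.< start (at i) ℕ.+ k
      ends> i j (_ , hi) rewrite start-at i | position-at j = hi

      -- If window j comes later, f j was already visible in window i and `falls` applies; if it
      -- comes earlier, f j is still visible in window i and `climbs` applies.
      higher : ∀ i j → window i (f j) → f j ≢ f i → height (at j) ℕ.< height (at i)
      higher i j j∈i fj≢fi with Fin.<-cmp i j
      ... | tri≈ _ refl _ = contradiction refl fj≢fi
      ... | tri< i<j _ _ with falls (at⇝ i<j) (ends> i j j∈i)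
      ...   | inj₂ lower     = lower
      ...   | inj₁ (eq , _) = contradiction
              (Fin.toℕ-injective (trans (sym (position-at j)) (trans (sym eq) (position-at i)))) fj≢fi
      higher i j j∈i fj≢fi | tri> _ _ j<i with climbs (at⇝ j<i) (starts≤ i j j∈i)
      ...   | inj₂ lower     = lower
      ...   | inj₁ (eq , _) = contradiction
              (Fin.toℕ-injective (trans (sym (position-at j)) (trans eq (position-at i)))) fj≢fi

      -- A coordinate chosen twice lies in both windows, so `falls` and `climbs` both apply, and
      -- their strict alternatives contradict each other.
      height-cong-< : ∀ i j → i Fin.< j → f i ≡ f j → height (at i) ≡ height (at j)
      height-cong-< i j i<j fi≡fj
        with falls (at⇝ i<j) (ends> i j (subst (window i) fi≡fj (chosen∈ i)))
           | climbs (at⇝ i<j) (starts≤ j i (subst (window j) (sym fi≡fj) (chosen∈ j)))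
      ... | inj₁ (_ , eq) | _             = eq
      ... | inj₂ _        | inj₁ (_ , eq) = eq
      ... | inj₂ j<i      | inj₂ i<j′     = contradiction i<j′ (ℕ.<-asym j<i)

      height-cong : ∀ i j → f i ≡ f j → height (at i) ≡ height (at j)
      height-cong i j fi≡fj with Fin.<-cmp i j
      ... | tri< i<j _ _ = height-cong-< i j i<j fi≡fj
      ... | tri≈ _ i≡j _ = cong (height ∘ at) i≡j
      ... | tri> _ _ j<i = sym (height-cong-< j i j<i (sym fi≡fj))

      -- `height-cong` makes the value independent of the window found by the search; the successor
      -- keeps 0 for unselected coordinates, below all selected ones.
      weight : Fin (dim (suc n) k s) → ℕ
      weight j with Fin.any? (λ i → f i Fin.≟ j)
      ... | yes (i , _) = suc (height (at i))
      ... | no  _       = 0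

      weight-chosen : ∀ i → weight (f i) ≡ suc (height (at i))
      weight-chosen i with Fin.any? (λ i′ → f i′ Fin.≟ f i)
      ... | yes (i′ , eq) = cong suc (height-cong i′ i eq)
      ... | no  none      = contradiction (i , refl) none

      weight-< : ∀ i j → window i j → j ≢ f i → weight j ℕ.< weight (f i)
      weight-< i j j∈i j≢fi rewrite weight-chosen i with Fin.any? (λ i′ → f i′ Fin.≟ j)
      ... | yes (i′ , refl) = s<s (higher i i′ j∈i j≢fi)
      ... | no  _           = z<s

    chosen-selects : Selects (λ j → weight j ×ᶠ 1#) window (chosen steps)
    chosen-selects i = chosen∈ i , λ j j∈i j≢fi → ×ᶠ-mono-< (weight-< i j j∈i j≢fi)

  module _ {a : Point (dim (suc n) k s)} {f : Vector (Fin (dim (suc n) k s)) (suc n)}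
           (sel : Selects a window f) where

    private
      offset : Fin (suc n) → ℕ
      offset i = toℕ (f i) ℕ.∸ s ℕ.* toℕ i

      position≡ : ∀ i → s ℕ.* toℕ i ℕ.+ offset i ≡ toℕ (f i)
      position≡ i = ℕ.m+[n∸m]≡n (proj₁ (proj₁ (sel i)))

      offset<k : ∀ i → offset i ℕ.< k
      offset<k i = ℕ.+-cancelˡ-< (s ℕ.* toℕ i) _ _
        (subst (ℕ._< s ℕ.* toℕ i ℕ.+ k) (sym (position≡ i)) (proj₂ (proj₁ (sel i))))

      conflict : ∀ i j → window i (f j) → window j (f i) → f i ≡ f j
      conflict i j j∈i i∈j with f i Fin.≟ f j
      ... | yes eq    = eq
      ... | no  fi≢fj = contradiction (proj₂ (sel i) (f j) j∈i (fi≢fj ∘ sym))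
                          (<-asym (proj₂ (sel j) (f i) i∈j fi≢fj))

      -- If f i has not expired and f j is not new, each lies in the other's window. Were they
      -- different, each would have to beat the other, so the coordinate is kept.
      adjacent : ∀ i j → toℕ j ≡ suc (toℕ i) → Step (offset i) (offset j)
      adjacent i j j≡1+i with offset i ℕ.<? s | e ℕ.≤? offset j
      ... | yes oi<s | _       = offset<k j , inj₁ oi<s
      ... | no  _    | yes e≤oj = offset<k j , inj₂ (inj₂ e≤oj)
      ... | no  oi≮s | no  e≰oj = offset<k j , inj₂ (inj₁ (ℕ.+-cancelˡ-≡ (s ℕ.* toℕ i) _ _ (begin
            s ℕ.* toℕ i ℕ.+ offset i            ≡⟨ position≡ i ⟩
            toℕ (f i)                           ≡⟨ cong toℕ (conflict i j j∈i i∈j) ⟩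
            toℕ (f j)                           ≡⟨ fj≡ ⟩
            s ℕ.* toℕ i ℕ.+ (s ℕ.+ offset j)    ∎)))
        where
        open ≡-Reasoning
        s*j≡ : s ℕ.* toℕ j ≡ s ℕ.* toℕ i ℕ.+ s
        s*j≡ = trans (cong (s ℕ.*_) j≡1+i) (trans (ℕ.*-suc s (toℕ i)) (ℕ.+-comm s _))
        fj≡ : toℕ (f j) ≡ s ℕ.* toℕ i ℕ.+ (s ℕ.+ offset j)
        fj≡ = trans (sym (position≡ j)) (trans (cong (ℕ._+ offset j) s*j≡) (ℕ.+-assoc (s ℕ.* toℕ i) s _))
        j∈i : window i (f j)
        j∈i = subst (s ℕ.* toℕ i ℕ.≤_) (sym fj≡) (ℕ.m≤m+n (s ℕ.* toℕ i) _)
            , subst (ℕ._< s ℕ.* toℕ i ℕ.+ k) (sym fj≡)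
                (ℕ.+-monoʳ-< (s ℕ.* toℕ i) (ℕ.+-monoʳ-< s (ℕ.≰⇒> e≰oj)))
        i∈j : window j (f i)
        i∈j = subst₂ ℕ._≤_ (sym s*j≡) (position≡ i) (ℕ.+-monoʳ-≤ (s ℕ.* toℕ i) (ℕ.≮⇒≥ oi≮s))
            , ℕ.<-≤-trans (proj₂ (proj₁ (sel i)))
                (ℕ.+-monoˡ-≤ k (subst (s ℕ.* toℕ i ℕ.≤_) (sym s*j≡) (ℕ.m≤m+n _ s)))

    selects⇒path : ∃ λ v → Linked Step (0 ∷ v) ×
      (∀ i → s ℕ.* toℕ i ℕ.+ lookup v i ≡ toℕ (f i))
    selects⇒path = tabulate offset
      , (offset<k zero , inj₁ 0<s) ∷ linked-tabulate offset adjacent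
      , λ i → trans (cong (s ℕ.* toℕ i ℕ.+_) (Vec.lookup∘tabulate offset i)) (position≡ i)

  vertices≡paths : ∀ {m} → HasVertexCount (polytope (suc n) k s) m → m ≡ count (suc n) 0
  vertices≡paths = vertexCount window window? window-nonempty
    (λ x → chosen (path x)) code-injective (λ x → _ , chosen-selects (path x)) code-complete
    where
    window? : ∀ i j → _
    window? i j = (s ℕ.* toℕ i ℕ.≤? toℕ j) ×-dec (toℕ j ℕ.<? s ℕ.* toℕ i ℕ.+ k)

    window-nonempty : ∀ i → ∃ (window i)
    window-nonempty i = fromℕ< (position< i 0<k) , lo , hi
      where
      lo : s ℕ.* toℕ i ℕ.≤ toℕ (fromℕ< (position< i 0<k))
      lo rewrite Fin.toℕ-fromℕ< (position< i 0<k) = ℕ.m≤m+n _ 0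
      hi : toℕ (fromℕ< (position< i 0<k)) ℕ.< s ℕ.* toℕ i ℕ.+ k
      hi rewrite Fin.toℕ-fromℕ< (position< i 0<k) = ℕ.+-monoʳ-< (s ℕ.* toℕ i) 0<k

    path : ∀ x → Linked Step (0 ∷ List.lookup (paths (suc n) 0) x)
    path x = paths⁻ 0<k (∈-lookup x)

    code-injective : ∀ {x y} → (∀ i → chosen (path x) i ≡ chosen (path y) i) → x ≡ y
    code-injective {x} {y} eq = lookup-injective (paths-unique (suc n) 0<k) (begin
      u                     ≡⟨ Vec.tabulate∘lookup u ⟨
      tabulate (lookup u)   ≡⟨ Vec.tabulate-cong (λ i → ℕ.+-cancelˡ-≡ (s ℕ.* toℕ i) _ _
                                 (trans (sym (toℕ-chosen (path x) i))
                                   (trans (cong toℕ (eq i)) (toℕ-chosen (path y) i)))) ⟩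
      tabulate (lookup v)   ≡⟨ Vec.tabulate∘lookup v ⟩
      v                     ∎)
      where
      open ≡-Reasoning
      u v : Vec ℕ (suc n)
      u = List.lookup (paths (suc n) 0) x
      v = List.lookup (paths (suc n) 0) y

    code-complete : ∀ {a f} → Selects a window f → ∃ λ x → ∀ i → chosen (path x) i ≡ f i
    code-complete sel with selects⇒path sel
    ... | v , steps , position≡ = Any.index v∈ , λ i → Fin.toℕ-injective
      (trans (toℕ-chosen (path (Any.index v∈)) i)
        (trans (cong (λ u → s ℕ.* toℕ i ℕ.+ lookup u i) (sym (lookup-index v∈))) (position≡ i)))
      where
      v∈ : v ∈ˡ paths (suc n) 0
      v∈ = paths⁺ steps

-- Formal power series

open import Data.Integer.Base using (_+_; _*_; -_; _-_)

module PowerSeries where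

  open Sum ℤ.+-0-commutativeMonoid using (sum-cong-≋)

  -- By definition (A ⊛ B) (n + 1) is A 0 * B (n + 1) + (tail A ⊛ B) n; the inductions below unfold
  -- products this way.
  tail : Series → Series
  tail A n = A (suc n)

  ⊝_ : Series → Series
  (⊝ A) n = - A n

  scale : ℤ → Series → Series
  scale a B n = a * B n

  ⊛-cong : ∀ {A A′ B B′} → A ≗ A′ → B ≗ B′ → A ⊛ B ≗ A′ ⊛ B′
  ⊛-cong A≗A′ B≗B′ n =
    sum-cong-≋ {suc n} λ i → cong₂ _*_ (A≗A′ (toℕ i)) (B≗B′ (n ℕ.∸ toℕ i))

  ⊛-distribʳ : ∀ C A B → (A ⊕ B) ⊛ C ≗ A ⊛ C ⊕ B ⊛ C
  ⊛-distribʳ C A B zero    = lemma (A 0) (B 0) (C 0)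
    where
    lemma : ∀ a b c → (a + b) * c + + 0 ≡ (a * c + + 0) + (b * c + + 0)
    lemma = solve-∀
  ⊛-distribʳ C A B (suc n) =
    trans (cong (λ z → (A 0 + B 0) * C (suc n) + z) (⊛-distribʳ C (tail A) (tail B) n))
      (lemma (A 0) (B 0) (C (suc n)) ((tail A ⊛ C) n) ((tail B ⊛ C) n))
    where
    lemma : ∀ a b c x y → (a + b) * c + (x + y) ≡ (a * c + x) + (b * c + y)
    lemma = solve-∀

  scale-⊛ : ∀ a B C → scale a B ⊛ C ≗ scale a (B ⊛ C)
  scale-⊛ a B C zero    = lemma a (B 0) (C 0)
    where
    lemma : ∀ a b c → a * b * c + + 0 ≡ a * (b * c + + 0)
    lemma = solve-∀
  scale-⊛ a B C (suc n) =
    trans (cong (λ z → a * B 0 * C (suc n) + z) (scale-⊛ a (tail B) C n))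
      (lemma a (B 0) (C (suc n)) ((tail B ⊛ C) n))
    where
    lemma : ∀ a b c x → a * b * c + a * x ≡ a * (b * c + x)
    lemma = solve-∀

  ⊛-assoc : ∀ A B C → (A ⊛ B) ⊛ C ≗ A ⊛ (B ⊛ C)
  ⊛-assoc A B C zero    = lemma (A 0) (B 0) (C 0)
    where
    lemma : ∀ a b c → (a * b + + 0) * c + + 0 ≡ a * (b * c + + 0) + + 0
    lemma = solve-∀
  ⊛-assoc A B C (suc n) = begin
    -- The tail of A ⊛ B unfolds to scale (A 0) (tail B) ⊕ tail A ⊛ B.
    (A 0 * B 0 + + 0) * C (suc n) + ((scale (A 0) (tail B) ⊕ tail A ⊛ B) ⊛ C) n
      ≡⟨ cong (λ z → (A 0 * B 0 + + 0) * C (suc n) + z)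
           (trans (⊛-distribʳ C (scale (A 0) (tail B)) (tail A ⊛ B) n)
             (cong₂ _+_ (scale-⊛ (A 0) (tail B) C n) (⊛-assoc (tail A) B C n))) ⟩
    (A 0 * B 0 + + 0) * C (suc n) + (A 0 * (tail B ⊛ C) n + (tail A ⊛ (B ⊛ C)) n)
      ≡⟨ lemma (A 0) (B 0) (C (suc n)) _ _ ⟩
    A 0 * (B 0 * C (suc n) + (tail B ⊛ C) n) + (tail A ⊛ (B ⊛ C)) n ∎
    where
    open ≡-Reasoning
    lemma : ∀ a b c x y → (a * b + + 0) * c + (a * x + y) ≡ a * (b * c + x) + y
    lemma = solve-∀

  -- The mirror image of the defining unfolding, peeling the right factor; commutativity follows by
  -- matching the two.
  ⊛-tailʳ : ∀ A B n → (A ⊛ B) (suc n) ≡ A (suc n) * B 0 + (A ⊛ tail B) n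
  ⊛-tailʳ A B zero    = lemma (A 0) (A 1) (B 0) (B 1)
    where
    lemma : ∀ a a′ b b′ → a * b′ + (a′ * b + + 0) ≡ a′ * b + (a * b′ + + 0)
    lemma = solve-∀
  ⊛-tailʳ A B (suc n) =
    trans (cong (λ z → A 0 * B (suc (suc n)) + z) (⊛-tailʳ (tail A) B n))
      (lemma (A 0 * B (suc (suc n))) (A (suc (suc n)) * B 0) ((tail A ⊛ tail B) n))
    where
    lemma : ∀ x y z → x + (y + z) ≡ y + (x + z)
    lemma = solve-∀

  ⊛-comm : ∀ A B → A ⊛ B ≗ B ⊛ A
  ⊛-comm A B zero    = cong (_+ + 0) (ℤ.*-comm (A 0) (B 0))
  ⊛-comm A B (suc n) =
    trans (cong₂ _+_ (ℤ.*-comm (A 0) (B (suc n))) (⊛-comm (tail A) B n))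
      (sym (⊛-tailʳ B A n))

  ⊛-zeroˡ : ∀ {Z} → (∀ n → Z n ≡ + 0) → ∀ A n → (Z ⊛ A) n ≡ + 0
  ⊛-zeroˡ z A zero    rewrite z 0 = refl
  ⊛-zeroˡ z A (suc n) rewrite z 0 =
    trans (cong (λ z → + 0 * A (suc n) + z) (⊛-zeroˡ (λ i → z (suc i)) A n)) (ℤ.+-identityʳ (+ 0 * A (suc n)))

  const-⊛ : ∀ a B → (a x^ 0) ⊛ B ≗ scale a B
  const-⊛ a B zero    = ℤ.+-identityʳ (a * B 0)
  const-⊛ a B (suc n) =
    trans (cong (λ z → a * B (suc n) + z) (⊛-zeroˡ (λ _ → refl) B n)) (ℤ.+-identityʳ (a * B (suc n)))

  ⊛-identityˡ : ∀ A → ((+ 1) x^ 0) ⊛ A ≗ A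
  ⊛-identityˡ A n = trans (const-⊛ (+ 1) A n) (ℤ.*-identityˡ (A n))

  seriesRing : CommutativeRing 0ℓ 0ℓ
  seriesRing = record
    { Carrier = Series
    ; _≈_ = _≗_
    ; _+_ = _⊕_
    ; _*_ = _⊛_
    ; -_ = ⊝_
    ; 0# = (+ 0) x^ 0
    ; 1# = (+ 1) x^ 0
    ; isCommutativeRing = record
      { isRing = record
        { +-isAbelianGroup = record
          { isGroup = record
            { isMonoid = record
              { isSemigroup = record
                { isMagma = record
                  { isEquivalence = record
                    { refl = λ _ → refl
                    ; sym = λ p n → sym (p n)
                    ; trans = λ p q n → trans (p n) (q n)
                    }
                  ; ∙-cong = λ p q n → cong₂ _+_ (p n) (q n)
                  }
                ; assoc = λ A B C n → ℤ.+-assoc (A n) (B n) (C n)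
                }
              ; identity = (λ A n → trans (cong (_+ A n) (0x^0 n)) (ℤ.+-identityˡ (A n)))
                         , (λ A n → trans (cong (λ z → A n + z) (0x^0 n)) (ℤ.+-identityʳ (A n)))
              }
            ; inverse = (λ A n → trans (ℤ.+-inverseˡ (A n)) (sym (0x^0 n)))
                      , (λ A n → trans (ℤ.+-inverseʳ (A n)) (sym (0x^0 n)))
            ; ⁻¹-cong = λ p n → cong -_ (p n)
            }
          ; comm = λ A B n → ℤ.+-comm (A n) (B n)
          }
        ; *-cong = ⊛-cong
        ; *-assoc = ⊛-assoc
        ; *-identity = ⊛-identityˡ
                     , (λ A n → trans (⊛-comm A ((+ 1) x^ 0) n) (⊛-identityˡ A n))
        ; distrib = (λ A B C n → trans (⊛-comm A (B ⊕ C) n)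
                       (trans (⊛-distribʳ A B C n) (cong₂ _+_ (⊛-comm B A n) (⊛-comm C A n))))
                  , ⊛-distribʳ
        }
      ; *-comm = ⊛-comm
      }
    }
    where
    0x^0 : ∀ n → ((+ 0) x^ 0) n ≡ + 0
    0x^0 zero    = refl
    0x^0 (suc n) = refl

  private
    x : Series
    x = (+ 1) x^ 1

  constants : CommutativeRing.rawRing ℤ.+-*-commutativeRing
                -Raw-AlmostCommutative⟶ fromCommutativeRing seriesRing
  constants = record
    { ⟦_⟧    = _x^ 0
    ; +-homo = λ { a b zero → refl ; a b (suc n) → refl }
    ; *-homo = *-homo
    ; -‿homo = λ { a zero → refl ; a (suc n) → refl }
    ; 0-homo = λ _ → refl
    ; 1-homo = λ _ → refl
    }
    where
    *-homo : ∀ a b → (a * b) x^ 0 ≗ (a x^ 0) ⊛ (b x^ 0)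
    *-homo a b n = trans (lemma n) (sym (const-⊛ a (b x^ 0) n))
      where
      lemma : (a * b) x^ 0 ≗ scale a (b x^ 0)
      lemma zero    = refl
      lemma (suc n) = sym (ℤ.*-zeroʳ a)

  x⊛-suc : ∀ A n → (x ⊛ A) (suc n) ≡ A n
  x⊛-suc A n = begin
    + 0 * A (suc n) + (tail x ⊛ A) n  ≡⟨ cong (_+ (tail x ⊛ A) n) (ℤ.*-zeroˡ (A (suc n))) ⟩
    + 0 + (tail x ⊛ A) n              ≡⟨ ℤ.+-identityˡ _ ⟩
    (tail x ⊛ A) n                    ≡⟨ ⊛-cong {B = A} tail-x (λ _ → refl) n ⟩
    (((+ 1) x^ 0) ⊛ A) n              ≡⟨ ⊛-identityˡ A n ⟩
    A n                               ∎
    where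
    open ≡-Reasoning
    tail-x : tail x ≗ (+ 1) x^ 0
    tail-x zero    = refl
    tail-x (suc _) = refl

  monomial : ∀ a m → a x^ m ≗ (a x^ 0) ⊛ ((+ 1) x^ m)
  monomial a m n = sym (trans (const-⊛ a ((+ 1) x^ m) n) (lemma m n))
    where
    lemma : ∀ m n → a * ((+ 1) x^ m) n ≡ (a x^ m) n
    lemma zero    zero    = ℤ.*-identityʳ a
    lemma zero    (suc n) = ℤ.*-zeroʳ a
    lemma (suc m) zero    = ℤ.*-zeroʳ a
    lemma (suc m) (suc n) = lemma m n

  x^suc : ∀ m → (+ 1) x^ suc m ≗ x ⊛ ((+ 1) x^ m)
  x^suc m zero    = refl
  x^suc m (suc n) = sym (x⊛-suc ((+ 1) x^ m) n)

  -- Multiplying by `inverse D` reduces a claim about a quotient to the division-free recurrence D ⊛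
  -- C ≗ A.
  quotient-unique : ∀ A D C → D 0 ≡ + 1 → D ⊛ C ≗ A → C ≗ A ÷ D
  quotient-unique A D C D₀≡1 DC≗A n = begin
    C n                          ≡⟨ ⊛-identityˡ C n ⟨
    (((+ 1) x^ 0) ⊛ C) n         ≡⟨ ⊛-cong {B = C} (⊛-inverseʳ D D₀≡1) (λ _ → refl) n ⟨
    ((D ⊛ inverse D) ⊛ C) n      ≡⟨ ⊛-cong {B = C} (⊛-comm D (inverse D)) (λ _ → refl) n ⟩
    ((inverse D ⊛ D) ⊛ C) n      ≡⟨ ⊛-assoc (inverse D) D C n ⟩
    (inverse D ⊛ (D ⊛ C)) n      ≡⟨ ⊛-cong {A = inverse D} (λ _ → refl) DC≗A n ⟩
    (inverse D ⊛ A) n            ≡⟨ ⊛-comm (inverse D) A n ⟩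
    (A ⊛ inverse D) n            ∎
    where open ≡-Reasoning

  ⊛-cancelˡ : ∀ D {A B} → D 0 ≡ + 1 → D ⊛ A ≗ D ⊛ B → A ≗ B
  ⊛-cancelˡ D {A} {B} D₀≡1 DA≗DB n =
    trans (quotient-unique (D ⊛ B) D A D₀≡1 DA≗DB n)
      (sym (quotient-unique (D ⊛ B) D B D₀≡1 (λ _ → refl) n))

-- Generating functions

module GeneratingFunctions (s e : ℕ) (0<s : 0 ℕ.< s) where

  open PowerSeries
  open Paths s e

  pathSeries : Series
  pathSeries n = + count n 0

  shortOverlap : e ℕ.≤ s → pathSeries ≗
    (+ 1) x^ 0
    ÷ ((+ 1) x^ 0 ⊖ (+ (s ℕ.+ e)) x^ 1
      ⊕ ((+ (s ℕ.+ e) - + s) * (+ (s ℕ.+ e) - + s - + 1)) x^ 2)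
  shortOverlap e≤s = quotient-unique ((+ 1) x^ 0) D C refl recurrence
    where
    k : ℕ
    k = s ℕ.+ e
    κ : ℤ
    κ = (+ k - + s) * (+ k - + s - + 1)
    C D : Series
    C = pathSeries
    D = (+ 1) x^ 0 ⊖ (+ k) x^ 1 ⊕ κ x^ 2

    tail²-D : tail (tail D) ≗ κ x^ 0
    tail²-D zero    = ℤ.+-identityˡ κ
    tail²-D (suc n) = refl

    recurrence : D ⊛ C ≗ (+ 1) x^ 0
    recurrence zero          = refl
    recurrence (suc zero)    = begin
      + 1 * + count 1 0 + ((+ 0 - + k + + 0) * + 1 + + 0)
        ≡⟨ cong (λ c → + 1 * + c + ((+ 0 - + k + + 0) * + 1 + + 0)) count-1 ⟩
      + 1 * + k + ((+ 0 - + k + + 0) * + 1 + + 0)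
        ≡⟨ lemma (+ k) ⟩
      + 0 ∎
      where
      open ≡-Reasoning
      count-1 : count 1 0 ≡ k
      count-1 = trans (count-low 0 0<s)
        (trans (sum-applyUpTo-const (e ℕ.+ s) λ _ → refl) (trans (ℕ.*-identityʳ _) (ℕ.+-comm e s)))
      lemma : ∀ k → + 1 * k + ((+ 0 - k + + 0) * + 1 + + 0) ≡ + 0
      lemma = solve-∀
    -- Eliminating u from c₁ = e c₀ + u and c₂ = s c₁ + e (c₀ + u) gives c₂ = (s + e) c₁ - e (e - 1)
    -- c₀, the source of the coefficient of x^2, where e = k - s.
    recurrence (suc (suc n)) = begin
      + 1 * + c₂ + ((+ 0 - + k + + 0) * + c₁ + (tail (tail D) ⊛ C) n)
        ≡⟨ cong (λ z → + 1 * + c₂ + ((+ 0 - + k + + 0) * + c₁ + z))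
             (trans (⊛-cong {B = C} tail²-D (λ _ → refl) n) (const-⊛ κ C n)) ⟩
      + 1 * + c₂ + ((+ 0 - + k + + 0) * + c₁ + κ * + c₀)
        ≡⟨ lemma (+ c₂) (+ c₁) (+ c₀) (+ s) (+ e) (+ u) c₁-eq c₂-eq ⟩
      + 0 ∎
      where
      open ≡-Reasoning
      c₀ c₁ c₂ u : ℕ
      c₀ = count n 0
      c₁ = count (suc n) 0
      c₂ = count (suc (suc n)) 0
      u  = renewals n
      c₁-eq : + c₁ ≡ + e * + c₀ + + u
      c₁-eq = trans (cong +_ (count-split 0<s e≤s n)) (cong (_+ + u) (ℤ.pos-* e c₀))
      c₂-eq : + c₂ ≡ + s * + c₁ + + e * (+ c₀ + + u)
      c₂-eq = trans (cong +_ (count-split₂ 0<s e≤s n))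
        (cong₂ _+_ (ℤ.pos-* s c₁) (ℤ.pos-* e (c₀ ℕ.+ u)))
      identity : ∀ c₀ s e u → let c₁ = e * c₀ + u in
        + 1 * (s * c₁ + e * (c₀ + u))
          + ((+ 0 - (s + e) + + 0) * c₁ + (s + e - s) * (s + e - s - + 1) * c₀) ≡ + 0
      identity = solve-∀
      lemma : ∀ c₂ c₁ c₀ s e u → c₁ ≡ e * c₀ + u → c₂ ≡ s * c₁ + e * (c₀ + u) →
        + 1 * c₂ + ((+ 0 - (s + e) + + 0) * c₁ + (s + e - s) * (s + e - s - + 1) * c₀) ≡ + 0
      lemma _ _ c₀ s e u refl refl = identity c₀ s e u

-- Window length divisible by the shift

module DivisibleCase (s r : ℕ) (0<s : 0 ℕ.< s) where

  open PowerSeries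
  open Paths s (s ℕ.* r)
  open GeneratingFunctions s (s ℕ.* r) 0<s using (pathSeries)
  open Elimination seriesRing constants

  private
    con : ℤ → Series
    con a = a x^ 0

    x V : Series
    x = (+ 1) x^ 1

    X T Z : ℕ → Series
    X m = (+ 1) x^ m
    T q n = + count n (s ℕ.* q)
    Z q n = + ℕ.sum (applyUpTo (λ i → count n (s ℕ.* i)) q)

    -- The s new positions form the class r, so coefficient n + 1 is `renewals n`. The constant term
    -- 1 counts the empty path and makes `T-suc` hold in degree 0.
    V = con (+ 1) ⊕ x ⊛ (con (+ s) ⊛ T r)

    V-suc : ∀ n → V (suc n) ≡ + renewals n
    V-suc n = begin
      + 0 + (x ⊛ (con (+ s) ⊛ T r)) (suc n)  ≡⟨ ℤ.+-identityˡ _ ⟩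
      (x ⊛ (con (+ s) ⊛ T r)) (suc n)        ≡⟨ x⊛-suc (con (+ s) ⊛ T r) n ⟩
      (con (+ s) ⊛ T r) n                    ≡⟨ const-⊛ (+ s) (T r) n ⟩
      + s * + count n (s ℕ.* r)                ≡⟨ ℤ.pos-* s _ ⟨
      + (s ℕ.* count n (s ℕ.* r))
        ≡⟨ cong +_ (sum-applyUpTo-const s (count-class 0<s n r)) ⟨
      + renewals n ∎
      where open ≡-Reasoning

    T-suc : ∀ q → T (suc q) ≗ x ⊛ T q ⊕ V
    T-suc q zero    = refl
    T-suc q (suc n) = begin
      + count (suc n) (s ℕ.* suc q)            ≡⟨ cong (+_ ∘ count (suc n)) (ℕ.*-suc s q) ⟩
      + count (suc n) (s ℕ.+ s ℕ.* q)          ≡⟨ cong +_ (count-high n (s ℕ.* q)) ⟩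
      T q n + + renewals n                     ≡⟨ cong₂ _+_ (x⊛-suc (T q) n) (V-suc n) ⟨
      (x ⊛ T q) (suc n) + V (suc n)            ∎
      where open ≡-Reasoning

    T-zero : T 0 ≗ pathSeries
    T-zero n = cong (+_ ∘ count n) (ℕ.*-zeroʳ s)

    Z-zero : Z 0 ≗ con (+ 0)
    Z-zero zero    = refl
    Z-zero (suc n) = refl

    Z-suc : ∀ q → Z (suc q) ≗ Z q ⊕ T q
    Z-suc q n = cong +_ (sum-applyUpTo-suc (λ i → count n (s ℕ.* i)) q)

    C-eq : T 0 ≗ con (+ 1) ⊕ x ⊛ (con (+ s) ⊛ Z (suc r))
    C-eq zero    = refl
    C-eq (suc n) = begin
      + count (suc n) (s ℕ.* 0)
        ≡⟨ T-zero (suc n) ⟩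
      + count (suc n) 0
        ≡⟨ cong +_ (count-low n 0<s) ⟩
      + ℕ.sum (applyUpTo (count n) (s ℕ.* r ℕ.+ s))
        ≡⟨ cong (+_ ∘ ℕ.sum ∘ applyUpTo (count n)) (trans (ℕ.*-suc s r) (ℕ.+-comm s (s ℕ.* r))) ⟨
      + ℕ.sum (applyUpTo (count n) (s ℕ.* suc r))
        ≡⟨ cong +_ (sum-classes 0<s n (suc r)) ⟩
      + (s ℕ.* ℕ.sum (applyUpTo (λ i → count n (s ℕ.* i)) (suc r)))
        ≡⟨ ℤ.pos-* s _ ⟩
      + s * Z (suc r) n
        ≡⟨ const-⊛ (+ s) (Z (suc r)) n ⟨
      (con (+ s) ⊛ Z (suc r)) n
        ≡⟨ x⊛-suc (con (+ s) ⊛ Z (suc r)) n ⟨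
      (x ⊛ (con (+ s) ⊛ Z (suc r))) (suc n)
        ≡⟨ ℤ.+-identityˡ _ ⟨
      + 0 + (x ⊛ (con (+ s) ⊛ Z (suc r))) (suc n) ∎
      where open ≡-Reasoning

    open Geometric x V X T Z (λ _ → refl) x^suc T-suc Z-zero Z-suc

    A D : Series
    A = (+ 1) x^ 0 ⊕ (+ r * + s - + s - + 2) x^ 1 ⊖ (+ r * + s - + 1) x^ 2
          ⊕ (+ s) x^ (1 ℕ.+ r)
    D = (+ 1) x^ 0 ⊖ (+ 2 * (+ s + + 1)) x^ 1 ⊕ ((+ s + + 1) * (+ s + + 1)) x^ 2
          ⊕ (+ s) x^ (1 ℕ.+ r) ⊖ (+ s * + s * (+ r + + 1)) x^ (2 ℕ.+ r)
          ⊕ (+ s * (+ r * + s - + 1)) x^ (3 ℕ.+ r)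

    open _-Raw-AlmostCommutative⟶_ constants using (+-homo; *-homo; -‿homo)

    -- Coefficients in `A` and `D` are computed as integers and then embedded, whereas the
    -- elimination computes with embedded constants. `term` and the operators below translate,
    -- following the shape of each coefficient.
    term : ∀ {a A′ B} m → con a ≗ A′ → X m ≗ B → a x^ m ≗ A′ ⊛ B
    term {a} m a≗ X≗ n = trans (monomial a m n) (⊛-cong a≗ X≗ n)

    infixl 6 _+ᶜ_ _-ᶜ_
    infixl 7 _*ᶜ_
    _+ᶜ_ : ∀ {a b A B} → con a ≗ A → con b ≗ B → con (a + b) ≗ A ⊕ B
    _+ᶜ_ {a} {b} p q n = trans (+-homo a b n) (cong₂ _+_ (p n) (q n))
    _-ᶜ_ : ∀ {a b A B} → con a ≗ A → con b ≗ B → con (a - b) ≗ A ⊖ B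
    _-ᶜ_ {a} {b} p q n = trans (+-homo a (- b) n) (cong₂ _+_ (p n) (trans (-‿homo b n) (cong -_ (q n))))
    _*ᶜ_ : ∀ {a b A B} → con a ≗ A → con b ≗ B → con (a * b) ≗ A ⊛ B
    _*ᶜ_ {a} {b} p q n = trans (*-homo a b n) (⊛-cong p q n)

    ‵1 : con (+ 1) ≗ con (+ 1)
    ‵1 _ = refl
    ‵2 : con (+ 2) ≗ con (+ 1) ⊕ con (+ 1)
    ‵2 = +-homo (+ 1) (+ 1)
    ‵s : con (+ s) ≗ con (+ s)
    ‵s _ = refl
    ‵r : con (+ r) ≗ con (+ r)
    ‵r _ = refl

    x²y x³y : Series
    x²y = x ⊛ (x ⊛ X r)
    x³y = x ⊛ x²y

    X-2+r : X (2 ℕ.+ r) ≗ x²y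
    X-2+r n = trans (x^suc (1 ℕ.+ r) n) (⊛-cong {A = x} (λ _ → refl) (x^suc r) n)

    X-3+r : X (3 ℕ.+ r) ≗ x³y
    X-3+r n = trans (x^suc (2 ℕ.+ r) n) (⊛-cong {A = x} (λ _ → refl) X-2+r n)

    A≗ : A ≗ numerator x (X r) (con (+ s)) (con (+ r))
    A≗ n = cong₂ _+_ (cong₂ _-_ (cong₂ _+_ (refl {x = con (+ 1) n})
      (term 1 (‵r *ᶜ ‵s -ᶜ ‵s -ᶜ ‵2) (λ _ → refl) n))
      (term 2 (‵r *ᶜ ‵s -ᶜ ‵1) (x^suc 1) n))
      (term (1 ℕ.+ r) ‵s (x^suc r) n)

    D≗ : D ≗ denominator x (X r) (con (+ s)) (con (+ r))
    D≗ n = cong₂ _+_ (cong₂ _-_ (cong₂ _+_ (cong₂ _+_ (cong₂ _-_ (refl {x = con (+ 1) n})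
      (term 1 (‵2 *ᶜ (‵s +ᶜ ‵1)) (λ _ → refl) n))
      (term 2 ((‵s +ᶜ ‵1) *ᶜ (‵s +ᶜ ‵1)) (x^suc 1) n))
      (term (1 ℕ.+ r) ‵s (x^suc r) n))
      (term (2 ℕ.+ r) (‵s *ᶜ ‵s *ᶜ (‵r +ᶜ ‵1)) X-2+r n))
      (term (3 ℕ.+ r) (‵s *ᶜ (‵r *ᶜ ‵s -ᶜ ‵1)) X-3+r n)

    D⊛C≗A : D ⊛ pathSeries ≗ A
    -- The elimination leaves the common factor 1 - x, which cancels because its constant
    -- coefficient is 1.
    D⊛C≗A = ⊛-cancelˡ 1-x refl λ n → begin
      (1-x ⊛ (D ⊛ pathSeries)) n
        ≡⟨ ⊛-cong {A = 1-x} (λ _ → refl) (⊛-cong D≗ (λ i → sym (T-zero i))) n ⟩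
      (1-x ⊛ (denominator x (X r) (con (+ s)) (con (+ r)) ⊛ T 0)) n
        ≡⟨ generatingFunction (con (+ s)) r (λ _ → refl) C-eq n ⟩
      (1-x ⊛ numerator x (X r) (con (+ s)) (con (+ r))) n
        ≡⟨ ⊛-cong {A = 1-x} (λ _ → refl) A≗ n ⟨
      (1-x ⊛ A) n ∎
      where
      open ≡-Reasoning
      1-x : Series
      1-x = con (+ 1) ⊖ x

  divisible : pathSeries ≗ A ÷ D
  divisible = quotient-unique A D pathSeries refl D⊛C≗A

-- Generating functions of the vertex numbers

module _ {c ℓ₁ ℓ₂ ℓ₃} (F : OrderedField c ℓ₁ ℓ₂ ℓ₃) where

  open Polytopes F

  genFun≗pathSeries : ∀ s e (0<s : 0 ℕ.< s) (b : ℕ → ℕ) →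
    (∀ n .{{_ : NonZero n}} → HasVertexCount (polytope n (s ℕ.+ e) s) (b n)) →
    genFun b ≗ GeneratingFunctions.pathSeries s e 0<s
  genFun≗pathSeries s e 0<s b vertices zero    = refl
  genFun≗pathSeries s e 0<s b vertices (suc n) =
    cong +_ (Windows.vertices≡paths F s e 0<s n (vertices (suc n)))

  module _ (k s : ℕ) .{{_ : NonZero s}} (b : ℕ → ℕ)
           (vertices : ∀ n .{{_ : NonZero n}} → HasVertexCount (polytope n k s) (b n)) where

    private
      0<s : 0 ℕ.< s
      0<s = ℕ.>-nonZero⁻¹ s

    shortOverlapCase : ∀ e → e ℕ.≤ s → k ≡ s ℕ.+ e → genFun b ≗
      (+ 1) x^ 0
      ÷ ((+ 1) x^ 0 ⊖ (+ k) x^ 1 ⊕ ((+ k - + s) * (+ k - + s - + 1)) x^ 2)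
    shortOverlapCase e e≤s refl n = trans (genFun≗pathSeries s e 0<s b vertices n)
      (GeneratingFunctions.shortOverlap s e 0<s e≤s n)

    divisibleCase : ∀ r → k ≡ s ℕ.+ s ℕ.* r → genFun b ≗
      ((+ 1) x^ 0 ⊕ (+ r * + s - + s - + 2) x^ 1 ⊖ (+ r * + s - + 1) x^ 2
        ⊕ (+ s) x^ (1 ℕ.+ r))
      ÷ ((+ 1) x^ 0 ⊖ (+ 2 * (+ s + + 1)) x^ 1 ⊕ ((+ s + + 1) * (+ s + + 1)) x^ 2
          ⊕ (+ s) x^ (1 ℕ.+ r) ⊖ (+ s * + s * (+ r + + 1)) x^ (2 ℕ.+ r)
          ⊕ (+ s * (+ r * + s - + 1)) x^ (3 ℕ.+ r))
    divisibleCase r refl n = trans (genFun≗pathSeries s (s ℕ.* r) 0<s b vertices n)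
      (DivisibleCase.divisible s r 0<s n)

    -- This is the divisible case with r = k - 1. Purely numerical coefficients such as 2 (s + 1)
    -- compute; only the four that contain r have to be rewritten in terms of k.
    unitShiftCase : ∀ r → k ≡ suc r → s ≡ 1 → genFun b ≗
      ((+ 1) x^ 0 ⊕ (+ k - + 4) x^ 1 ⊖ (+ k - + 2) x^ 2 ⊕ (+ 1) x^ k)
      ÷ ((+ 1) x^ 0 ⊖ (+ 4) x^ 1 ⊕ (+ 4) x^ 2
          ⊕ (+ 1) x^ k ⊖ (+ k) x^ (1 ℕ.+ k) ⊕ (+ k - + 2) x^ (2 ℕ.+ k))
    unitShiftCase r refl refl n = begin
      genFun b n
        ≡⟨ divisibleCase r (cong suc (sym (ℕ.*-identityˡ r))) n ⟩
      quotient (+ r * + 1 - + 1 - + 2) (+ r * + 1 - + 1) d d′ n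
        ≡⟨ cong₂ (λ a a′ → quotient a a′ d d′ n) (k-4 (+ r)) (k-2 (+ r)) ⟩
      quotient (+ k - + 4) (+ k - + 2) d d′ n
        ≡⟨ cong₂ (λ d d′ → quotient (+ k - + 4) (+ k - + 2) d d′ n) (k≡ (+ r)) (1*[k-2] (+ r)) ⟩
      quotient (+ k - + 4) (+ k - + 2) (+ k) (+ k - + 2) n ∎
      where
      open ≡-Reasoning
      quotient : ℤ → ℤ → ℤ → ℤ → Series
      quotient a a′ d d′ =
        ((+ 1) x^ 0 ⊕ a x^ 1 ⊖ a′ x^ 2 ⊕ (+ 1) x^ k)
        ÷ ((+ 1) x^ 0 ⊖ (+ 4) x^ 1 ⊕ (+ 4) x^ 2
            ⊕ (+ 1) x^ k ⊖ d x^ (1 ℕ.+ k) ⊕ d′ x^ (2 ℕ.+ k))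
      d d′ : ℤ
      d  = + 1 * + 1 * (+ r + + 1)
      d′ = + 1 * (+ r * + 1 - + 1)
      k-4 : ∀ r → r * + 1 - + 1 - + 2 ≡ + 1 + r - + 4
      k-4 = solve-∀
      k-2 : ∀ r → r * + 1 - + 1 ≡ + 1 + r - + 2
      k-2 = solve-∀
      k≡ : ∀ r → + 1 * + 1 * (r + + 1) ≡ + 1 + r
      k≡ = solve-∀
      1*[k-2] : ∀ r → + 1 * (r * + 1 - + 1) ≡ + 1 + r - + 2
      1*[k-2] = solve-∀

⌈k/2⌉≤s⇒k∸s≤s : ∀ k {s} → ⌈ k /2⌉ ℕ.≤ s → k ℕ.∸ s ℕ.≤ s
⌈k/2⌉≤s⇒k∸s≤s k {s} ⌈k/2⌉≤s = ℕ.m≤n+o⇒m∸n≤o k s (begin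
  k                      ≡⟨ ℕ.⌊n/2⌋+⌈n/2⌉≡n k ⟨
  ⌊ k /2⌋ ℕ.+ ⌈ k /2⌉    ≤⟨ ℕ.+-mono-≤ (ℕ.≤-trans (ℕ.⌊n/2⌋≤⌈n/2⌉ k) ⌈k/2⌉≤s) ⌈k/2⌉≤s ⟩
  s ℕ.+ s                ∎)
  where open ℕ.≤-Reasoning

theorem1p2 : ∀ {c ℓ₁ ℓ₂ ℓ₃} (F : OrderedField c ℓ₁ ℓ₂ ℓ₃) (let open Polytopes F) →
    (k s : ℕ) .{{_ : NonZero k}} .{{_ : NonZero s}} (b : ℕ → ℕ) →
    (∀ n .{{_ : NonZero n}} → HasVertexCount (polytope n k s) (b n)) →
    (⌈ k /2⌉ ℕ.≤ s → s ℕ.≤ k →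
    genFun b ≗
    (+ 1) x^ 0
    ÷ ((+ 1) x^ 0 ⊖ (+ k) x^ 1 ⊕ ((+ k - + s) * (+ k - + s - + 1)) x^ 2))
    ×
    (∀ r → k ≡ s ℕ.* (1 ℕ.+ r) →
    genFun b ≗
    ((+ 1) x^ 0 ⊕ (+ r * + s - + s - + 2) x^ 1 ⊖ (+ r * + s - + 1) x^ 2
    ⊕ (+ s) x^ (1 ℕ.+ r))
    ÷ ((+ 1) x^ 0 ⊖ (+ 2 * (+ s + + 1)) x^ 1 ⊕ ((+ s + + 1) * (+ s + + 1)) x^ 2
    ⊕ (+ s) x^ (1 ℕ.+ r) ⊖ (+ s * + s * (+ r + + 1)) x^ (2 ℕ.+ r)
    ⊕ (+ s * (+ r * + s - + 1)) x^ (3 ℕ.+ r)))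
    ×
    (s ≡ 1 →
    genFun b ≗
    ((+ 1) x^ 0 ⊕ (+ k - + 4) x^ 1 ⊖ (+ k - + 2) x^ 2 ⊕ (+ 1) x^ k)
    ÷ ((+ 1) x^ 0 ⊖ (+ 4) x^ 1 ⊕ (+ 4) x^ 2
    ⊕ (+ 1) x^ k ⊖ (+ k) x^ (1 ℕ.+ k) ⊕ (+ k - + 2) x^ (2 ℕ.+ k)))
theorem1p2 F k s b vertices =
    (λ ⌈k/2⌉≤s s≤k → shortOverlapCase F k s b vertices (k ℕ.∸ s)
      (⌈k/2⌉≤s⇒k∸s≤s k ⌈k/2⌉≤s) (sym (ℕ.m+[n∸m]≡n s≤k)))
  , (λ r k≡s[1+r] → divisibleCase F k s b vertices r (trans k≡s[1+r] (ℕ.*-suc s r)))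
  , unitShiftCase F k s b vertices (ℕ.pred k) (sym (ℕ.suc-pred k))
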